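{- Let $q$ be a power of a prime $p$, and let $n=p^an'$ be a positive integer with $a=v_p(n)$ and $\gcd(p,n')=1$. Then in $\mathbb F_q[B,C]$: (1) $\Lambda_n(B,C)=\Lambda_{n'}(B,C)^{\varphi(p^a)}$; (2) $\mathcal V_n(B,C)=\mathcal V_{n'}(B,C)^{p^a}$; (3) $\mathcal U_n(B,C)=(B^2-4C)^{\frac{p^a-1}{2}}\,\mathcal U_{n'}(B,C)^{p^a}$ if $p$ is odd, and $\mathcal U_n(B,C)=B^{2^a-1}\,\mathcal U_{n'}(B,C)^{2^a}$ if $p=2$.
   Context: $v_p$ is the $p$-adic valuation and $\varphi$ is Euler's totient function. Let $B,C$ be algebraically independent indeterminates over $\mathbb F_q$. Lucas polynomials: $\mathcal U_0=0$, $\mathcal U_1=1$, $\mathcal U_n=-B\,\mathcal U_{n-1}-C\,\mathcal U_{n-2}$ and $\mathcal V_0=2$, $\mathcal V_1=-B$, $\mathcal V_n=-B\,\mathcal V_{n-1}-C\,\mathcal V_{n-2}$ for $n\ge2$. Lucas atoms: let $\alpha,\beta$ be the two roots of $T^2+BT+C$ in an algebraic closure of $\mathbb F_q(B,C)$. Let $\Phi_n(X)\in\mathbb F_q[X]$ be the $n$-th cyclotomic polynomial over $\mathbb F_q$ (the image of the integral one, also when $p\mid n$), and $\Phi_n^{\mathrm{hom}}(\alpha,\beta)=\beta^{\varphi(n)}\Phi_n(\alpha/\beta)$. The $n$-th Lucas atom $\Lambda_n(B,C)\in\mathbb F_q[B,C]$ is defined by $\Lambda_1(B,C)=1$ for $n=1$,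 and for $n\ge2$ as the unique polynomial with $\Lambda_n(B,C)=\Phi_n^{\mathrm{hom}}(\alpha,\beta)$.
   Formalization: Part (1) is stated only when n′ ≥ 2 or a = 0: for n′ = 1 and a ≥ 1 it is false, since Λ_1 = 1 while Λ_{p^a} = (α−β)^{φ(p^a)} ≠ 1 (e.g. p = n = 2 gives Λ_2 = −B). -}

module Defs where

open import Level as Level using (Level; _⊔_)
open import Algebra.Bundles using (CommutativeRing)
open import Algebra.Apartness.Bundles using (HeytingField; HeytingCommutativeRing)
open import Algebra.Morphism.Structures using (module RingMorphisms)
import Algebra.Properties.Semiring.Exp as Exp
import Algebra.Properties.Semiring.Mult as Mult
import Algebra.Properties.Ring as RingProperties
open import Data.Bool using (if_then_else_)
open import Data.Fin using (Fin)
open import Data.Integer using (ℤ; 0ℤ; +_; -[1+_])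
import Data.Integer.Properties as ℤ
open import Data.List using (List; []; _∷_; map; filter; length; upTo)
open import Data.List.Relation.Unary.All using (all?)
open import Data.Nat as ℕ using (ℕ; zero; suc; _≤_)
open import Data.Nat.Coprimality using (coprime?)
open import Data.Nat.Divisibility using (_∣_; _∤_; _∣?_)
open import Data.Product using (_×_; _,_; proj₁; proj₂; ∃; ∃₂; ∃-syntax)
open import Function using (_∘_)
open import Function.Bundles using (Inverse)
open import Relation.Binary.PropositionalEquality as ≡ using (_≡_)
open import Relation.Nullary using (¬_; does)
import Relation.Binary.Reasoning.Setoid as SetoidReasoning

private
  variable
    c ℓ ℓ′ f f₁ f₂ o o₁ o₂ : Level

φ : ℕ → ℕ
φ n = length (filter (coprime? n) (map suc (upTo n)))

IsValuation : (p n a : ℕ) → Set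
IsValuation p n a = (p ℕ.^ a ∣ n) × (p ℕ.^ suc a ∤ n)

-- A polynomial is the list of its coefficients, constant term first.  Trailing
-- zeros are allowed; equality is equality of all coefficients.

module Polynomial (R : CommutativeRing c ℓ) where

  open CommutativeRing R
  open RingProperties ring using (-0#≈0#)
  open SetoidReasoning setoid

  Poly : Set c
  Poly = List Carrier

  coeff : Poly → ℕ → Carrier
  coeff []      _       = 0#
  coeff (a ∷ _) zero    = a
  coeff (_ ∷ p) (suc i) = coeff p i

  infix 4 _≋_

  record _≋_ (p q : Poly) : Set ℓ where
    constructor coeffwise
    field
      coeff-≈ : ∀ i → coeff p i ≈ coeff q i

  open _≋_ public

  infixl 6 _⊕_
  infixl 7 _⊛_ _⊙_
  infix  8 ⊖_

  _⊕_ : Poly → Poly → Poly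
  []      ⊕ q       = q
  (a ∷ p) ⊕ []      = a ∷ p
  (a ∷ p) ⊕ (b ∷ q) = (a + b) ∷ (p ⊕ q)

  ⊖_ : Poly → Poly
  ⊖_ = map (-_)

  _⊙_ : Carrier → Poly → Poly
  a ⊙ p = map (a *_) p

  _⊛_ : Poly → Poly → Poly
  []      ⊛ q = []
  (a ∷ p) ⊛ q = a ⊙ q ⊕ (0# ∷ p ⊛ q)

  const : Carrier → Poly
  const a = a ∷ []

  X : Poly
  X = 0# ∷ 1# ∷ []

  eval : Poly → Carrier → Carrier
  eval []      x = 0#
  eval (a ∷ p) x = a + x * eval p x

  -- Quotient and remainder of the division by g, which is meant to be monic of
  -- degree m: if f = q g + r with deg r < m then a + X f = (e + X q) g + (a + X r - e g),
  -- where e is the coefficient of degree m of a + X r.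
  divModMonic : (g : Poly) (m : ℕ) → Poly → Poly × Poly
  divModMonic g m []      = [] , []
  divModMonic g m (a ∷ f) = e ∷ q , (a ∷ r) ⊕ ⊖ (e ⊙ g)
    where
    q = proj₁ (divModMonic g m f)
    r = proj₂ (divModMonic g m f)
    e = coeff (a ∷ r) m

  coeff-⊕ : ∀ p q i → coeff (p ⊕ q) i ≈ coeff p i + coeff q i
  coeff-⊕ []      q       i       = sym (+-identityˡ _)
  coeff-⊕ (a ∷ p) []      i       = sym (+-identityʳ _)
  coeff-⊕ (a ∷ p) (b ∷ q) zero    = refl
  coeff-⊕ (a ∷ p) (b ∷ q) (suc i) = coeff-⊕ p q i

  coeff-⊖ : ∀ p i → coeff (⊖ p) i ≈ - coeff p i
  coeff-⊖ []      i       = sym -0#≈0#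
  coeff-⊖ (a ∷ p) zero    = refl
  coeff-⊖ (a ∷ p) (suc i) = coeff-⊖ p i

  coeff-⊙ : ∀ a p i → coeff (a ⊙ p) i ≈ a * coeff p i
  coeff-⊙ a []      i       = sym (zeroʳ a)
  coeff-⊙ a (b ∷ p) zero    = refl
  coeff-⊙ a (b ∷ p) (suc i) = coeff-⊙ a p i

  ≋-refl : ∀ {p} → p ≋ p
  ≋-refl .coeff-≈ i = refl

  ≋-sym : ∀ {p q} → p ≋ q → q ≋ p
  ≋-sym p≋q .coeff-≈ i = sym (coeff-≈ p≋q i)

  ≋-trans : ∀ {p q r} → p ≋ q → q ≋ r → p ≋ r
  ≋-trans p≋q q≋r .coeff-≈ i = trans (coeff-≈ p≋q i) (coeff-≈ q≋r i)

  ∷-cong : ∀ {a b p q} → a ≈ b → p ≋ q → a ∷ p ≋ b ∷ q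
  ∷-cong a≈b p≋q .coeff-≈ zero    = a≈b
  ∷-cong a≈b p≋q .coeff-≈ (suc i) = coeff-≈ p≋q i

  tail-≋ : ∀ {a b p q} → a ∷ p ≋ b ∷ q → p ≋ q
  tail-≋ e .coeff-≈ i = coeff-≈ e (suc i)

  0∷-≋[] : ∀ {a p} → a ≈ 0# → p ≋ [] → a ∷ p ≋ []
  0∷-≋[] a≈0 p≋[] .coeff-≈ zero    = a≈0
  0∷-≋[] a≈0 p≋[] .coeff-≈ (suc i) = coeff-≈ p≋[] i

  tail-≋[] : ∀ {a p} → a ∷ p ≋ [] → p ≋ []
  tail-≋[] e .coeff-≈ i = coeff-≈ e (suc i)

  ⊕-cong : ∀ {p p′ q q′} → p ≋ p′ → q ≋ q′ → p ⊕ q ≋ p′ ⊕ q′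
  ⊕-cong {p} {p′} {q} {q′} e e′ .coeff-≈ i = begin
    coeff (p ⊕ q) i          ≈⟨ coeff-⊕ p q i ⟩
    coeff p i + coeff q i    ≈⟨ +-cong (coeff-≈ e i) (coeff-≈ e′ i) ⟩
    coeff p′ i + coeff q′ i  ≈⟨ coeff-⊕ p′ q′ i ⟨
    coeff (p′ ⊕ q′) i        ∎

  ⊖-cong : ∀ {p q} → p ≋ q → ⊖ p ≋ ⊖ q
  ⊖-cong {p} {q} e .coeff-≈ i =
    trans (coeff-⊖ p i) (trans (-‿cong (coeff-≈ e i)) (sym (coeff-⊖ q i)))

  ⊙-cong : ∀ {a b p q} → a ≈ b → p ≋ q → a ⊙ p ≋ b ⊙ q
  ⊙-cong {a} {b} {p} {q} a≈b e .coeff-≈ i =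
    trans (coeff-⊙ a p i) (trans (*-cong a≈b (coeff-≈ e i)) (sym (coeff-⊙ b q i)))

  ⊕-assoc : ∀ p q r → (p ⊕ q) ⊕ r ≋ p ⊕ (q ⊕ r)
  ⊕-assoc p q r .coeff-≈ i = begin
    coeff ((p ⊕ q) ⊕ r) i                  ≈⟨ coeff-⊕ (p ⊕ q) r i ⟩
    coeff (p ⊕ q) i + coeff r i            ≈⟨ +-congʳ (coeff-⊕ p q i) ⟩
    (coeff p i + coeff q i) + coeff r i    ≈⟨ +-assoc _ _ _ ⟩
    coeff p i + (coeff q i + coeff r i)    ≈⟨ +-congˡ (coeff-⊕ q r i) ⟨
    coeff p i + coeff (q ⊕ r) i            ≈⟨ coeff-⊕ p (q ⊕ r) i ⟨
    coeff (p ⊕ (q ⊕ r)) i                  ∎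

  ⊕-comm : ∀ p q → p ⊕ q ≋ q ⊕ p
  ⊕-comm p q .coeff-≈ i =
    trans (coeff-⊕ p q i) (trans (+-comm _ _) (sym (coeff-⊕ q p i)))

  ⊕-identityʳ : ∀ p → p ⊕ [] ≋ p
  ⊕-identityʳ p .coeff-≈ i = trans (coeff-⊕ p [] i) (+-identityʳ _)

  ⊖-inverseˡ : ∀ p → ⊖ p ⊕ p ≋ []
  ⊖-inverseˡ p .coeff-≈ i =
    trans (coeff-⊕ (⊖ p) p i) (trans (+-congʳ (coeff-⊖ p i)) (-‿inverseˡ _))

  ⊖-inverseʳ : ∀ p → p ⊕ ⊖ p ≋ []
  ⊖-inverseʳ p = ≋-trans (⊕-comm p (⊖ p)) (⊖-inverseˡ p)

  ⊕-interchange : ∀ p q r s → (p ⊕ q) ⊕ (r ⊕ s) ≋ (p ⊕ r) ⊕ (q ⊕ s)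
  ⊕-interchange p q r s =
    ≋-trans (⊕-assoc p q (r ⊕ s))
    (≋-trans (⊕-cong (≋-refl {p})
       (≋-trans (≋-sym (⊕-assoc q r s))
       (≋-trans (⊕-cong (⊕-comm q r) ≋-refl) (⊕-assoc r q s))))
    (≋-sym (⊕-assoc p r (q ⊕ s))))

  0⊙ : ∀ {a} p → a ≈ 0# → a ⊙ p ≋ []
  0⊙ {a} p a≈0 .coeff-≈ i = trans (coeff-⊙ a p i) (trans (*-congʳ a≈0) (zeroˡ _))

  ⊙-distribˡ : ∀ a p q → a ⊙ (p ⊕ q) ≋ a ⊙ p ⊕ a ⊙ q
  ⊙-distribˡ a p q .coeff-≈ i = begin
    coeff (a ⊙ (p ⊕ q)) i                ≈⟨ coeff-⊙ a (p ⊕ q) i ⟩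
    a * coeff (p ⊕ q) i                  ≈⟨ *-congˡ (coeff-⊕ p q i) ⟩
    a * (coeff p i + coeff q i)          ≈⟨ distribˡ _ _ _ ⟩
    a * coeff p i + a * coeff q i        ≈⟨ +-cong (coeff-⊙ a p i) (coeff-⊙ a q i) ⟨
    coeff (a ⊙ p) i + coeff (a ⊙ q) i    ≈⟨ coeff-⊕ (a ⊙ p) (a ⊙ q) i ⟨
    coeff (a ⊙ p ⊕ a ⊙ q) i              ∎

  ⊙-distribʳ : ∀ a b p → (a + b) ⊙ p ≋ a ⊙ p ⊕ b ⊙ p
  ⊙-distribʳ a b p .coeff-≈ i = begin
    coeff ((a + b) ⊙ p) i                ≈⟨ coeff-⊙ (a + b) p i ⟩
    (a + b) * coeff p i                  ≈⟨ distribʳ _ _ _ ⟩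
    a * coeff p i + b * coeff p i        ≈⟨ +-cong (coeff-⊙ a p i) (coeff-⊙ b p i) ⟨
    coeff (a ⊙ p) i + coeff (b ⊙ p) i    ≈⟨ coeff-⊕ (a ⊙ p) (b ⊙ p) i ⟨
    coeff (a ⊙ p ⊕ b ⊙ p) i              ∎

  ⊙-assoc : ∀ a b p → (a * b) ⊙ p ≋ a ⊙ (b ⊙ p)
  ⊙-assoc a b p .coeff-≈ i = begin
    coeff ((a * b) ⊙ p) i    ≈⟨ coeff-⊙ (a * b) p i ⟩
    (a * b) * coeff p i      ≈⟨ *-assoc _ _ _ ⟩
    a * (b * coeff p i)      ≈⟨ *-congˡ (coeff-⊙ b p i) ⟨
    a * coeff (b ⊙ p) i      ≈⟨ coeff-⊙ a (b ⊙ p) i ⟨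
    coeff (a ⊙ (b ⊙ p)) i    ∎

  1⊙ : ∀ p → 1# ⊙ p ≋ p
  1⊙ p .coeff-≈ i = trans (coeff-⊙ 1# p i) (*-identityˡ _)

  ⊛-zeroˡ : ∀ {p} q → p ≋ [] → p ⊛ q ≋ []
  ⊛-zeroˡ {[]}    q e = ≋-refl
  ⊛-zeroˡ {a ∷ p} q e =
    ⊕-cong (0⊙ q (coeff-≈ e 0)) (0∷-≋[] refl (⊛-zeroˡ q (tail-≋[] e)))

  ⊛-zeroʳ : ∀ p → p ⊛ [] ≋ []
  ⊛-zeroʳ []      = ≋-refl
  ⊛-zeroʳ (a ∷ p) = 0∷-≋[] refl (⊛-zeroʳ p)

  ⊛-congˡ : ∀ p {q q′} → q ≋ q′ → p ⊛ q ≋ p ⊛ q′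
  ⊛-congˡ []      e = ≋-refl
  ⊛-congˡ (a ∷ p) e = ⊕-cong (⊙-cong refl e) (∷-cong refl (⊛-congˡ p e))

  ⊛-congʳ : ∀ {p p′} q → p ≋ p′ → p ⊛ q ≋ p′ ⊛ q
  ⊛-congʳ {[]}    {p′}     q e = ≋-sym (⊛-zeroˡ {p′} q (≋-sym e))
  ⊛-congʳ {a ∷ p} {[]}     q e = ⊛-zeroˡ {a ∷ p} q e
  ⊛-congʳ {a ∷ p} {b ∷ p′} q e =
    ⊕-cong (⊙-cong (coeff-≈ e 0) ≋-refl) (∷-cong refl (⊛-congʳ q (tail-≋ e)))

  ⊛-∷ : ∀ p b q → p ⊛ (b ∷ q) ≋ b ⊙ p ⊕ (0# ∷ p ⊛ q)
  ⊛-∷ []      b q = ≋-sym (0∷-≋[] refl ≋-refl)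
  ⊛-∷ (a ∷ p) b q =
    ∷-cong (+-congʳ (*-comm a b))
      (≋-trans (⊕-cong ≋-refl (⊛-∷ p b q))
      (≋-trans (≋-sym (⊕-assoc (a ⊙ q) (b ⊙ p) _))
      (≋-trans (⊕-cong (⊕-comm (a ⊙ q) (b ⊙ p)) ≋-refl)
      (⊕-assoc (b ⊙ p) (a ⊙ q) _))))

  ⊛-comm : ∀ p q → p ⊛ q ≋ q ⊛ p
  ⊛-comm []      q = ≋-sym (⊛-zeroʳ q)
  ⊛-comm (a ∷ p) q =
    ≋-trans (⊕-cong ≋-refl (∷-cong refl (⊛-comm p q))) (≋-sym (⊛-∷ q a p))

  ⊛-distribʳ : ∀ r p q → (p ⊕ q) ⊛ r ≋ p ⊛ r ⊕ q ⊛ r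
  ⊛-distribʳ r []      q       = ≋-refl
  ⊛-distribʳ r (a ∷ p) []      = ≋-sym (⊕-identityʳ _)
  ⊛-distribʳ r (a ∷ p) (b ∷ q) =
    ≋-trans (⊕-cong (⊙-distribʳ a b r)
                    (∷-cong (sym (+-identityˡ 0#)) (⊛-distribʳ r p q)))
            (⊕-interchange (a ⊙ r) (b ⊙ r) (0# ∷ p ⊛ r) (0# ∷ q ⊛ r))

  ⊛-distribˡ : ∀ r p q → r ⊛ (p ⊕ q) ≋ r ⊛ p ⊕ r ⊛ q
  ⊛-distribˡ r p q =
    ≋-trans (⊛-comm r (p ⊕ q))
    (≋-trans (⊛-distribʳ r p q) (⊕-cong (⊛-comm p r) (⊛-comm q r)))

  ⊙-⊛ : ∀ a p q → (a ⊙ p) ⊛ q ≋ a ⊙ (p ⊛ q)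
  ⊙-⊛ a []      q = ≋-refl
  ⊙-⊛ a (b ∷ p) q =
    ≋-trans (⊕-cong (⊙-assoc a b q) (∷-cong (sym (zeroʳ a)) (⊙-⊛ a p q)))
            (≋-sym (⊙-distribˡ a (b ⊙ q) (0# ∷ p ⊛ q)))

  ⊛-assoc : ∀ p q r → (p ⊛ q) ⊛ r ≋ p ⊛ (q ⊛ r)
  ⊛-assoc []      q r = ≋-refl
  ⊛-assoc (a ∷ p) q r =
    ≋-trans (⊛-distribʳ r (a ⊙ q) (0# ∷ p ⊛ q))
            (⊕-cong (⊙-⊛ a q r) (⊕-cong (0⊙ r refl) (∷-cong refl (⊛-assoc p q r))))

  ⊛-identityˡ : ∀ p → const 1# ⊛ p ≋ p
  ⊛-identityˡ p =
    ≋-trans (⊕-cong (1⊙ p) (0∷-≋[] refl ≋-refl)) (⊕-identityʳ p)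

  polynomialRing : CommutativeRing c ℓ
  polynomialRing = record
    { Carrier = Poly
    ; _≈_ = _≋_
    ; _+_ = _⊕_
    ; _*_ = _⊛_
    ; -_  = ⊖_
    ; 0#  = []
    ; 1#  = const 1#
    ; isCommutativeRing = record
      { isRing = record
        { +-isAbelianGroup = record
          { isGroup = record
            { isMonoid = record
              { isSemigroup = record
                { isMagma = record
                  { isEquivalence = record
                    { refl = ≋-refl ; sym = ≋-sym ; trans = ≋-trans }
                  ; ∙-cong = ⊕-cong
                  }
                ; assoc = ⊕-assoc
                }
              ; identity = (λ p → ≋-refl) , ⊕-identityʳ
              }
            ; inverse = ⊖-inverseˡ , ⊖-inverseʳ
            ; ⁻¹-cong = ⊖-cong
            }
          ; comm = ⊕-comm
          }
        ; *-cong = λ {p} {p′} {q} {q′} e e′ → ≋-trans (⊛-congʳ q e) (⊛-congˡ p′ e′)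
        ; *-assoc = ⊛-assoc
        ; *-identity =
            ⊛-identityˡ , (λ p → ≋-trans (⊛-comm p (const 1#)) (⊛-identityˡ p))
        ; distrib = ⊛-distribˡ , ⊛-distribʳ
        }
      ; *-comm = ⊛-comm
      }
    }

open Polynomial using (polynomialRing)

module _ where

  ℤ[X] : CommutativeRing _ _
  ℤ[X] = polynomialRing ℤ.+-*-commutativeRing

  open CommutativeRing ℤ[X]
  open Exp semiring using (_^_)
  open Polynomial ℤ.+-*-commutativeRing using (X; divModMonic)

  degree : Carrier → ℕ
  degree []      = 0
  degree (a ∷ f) = if does (all? (ℤ._≟ 0ℤ) f) then 0 else suc (degree f)

  -- Φ is determined by X ^ n - 1 = ∏_{d ∣ n} Φ d: each Φ n is the exact quotient
  -- of X ^ n - 1 by the (monic) product of the Φ d over the proper divisors d of n.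
  -- Φ 0 is a dummy value.
  Φ           : ℕ → Carrier
  ∏Φ-divisors : (n k : ℕ) → Carrier

  Φ zero    = 1#
  Φ (suc n) = proj₁ (divModMonic g (degree g) (X ^ suc n - 1#))
    where g = ∏Φ-divisors (suc n) n

  -- The product of the Φ d over the divisors d of n with 1 ≤ d ≤ k.
  ∏Φ-divisors n zero    = 1#
  ∏Φ-divisors n (suc k) =
    (if does (suc k ∣? n) then Φ (suc k) else 1#) * ∏Φ-divisors n k

-- HeytingField does not provide its underlying commutative ring directly.
fieldRing : HeytingField f f₁ f₂ → CommutativeRing f f₁
fieldRing F =
  HeytingCommutativeRing.commutativeRing (HeytingField.heytingCommutativeRing F)

module _ (R : CommutativeRing c ℓ) (S : CommutativeRing f f₁) where
  open RingMorphisms (CommutativeRing.rawRing R) (CommutativeRing.rawRing S) public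
    using () renaming (IsRingHomomorphism to IsHomomorphism; IsRingMonomorphism to IsMonomorphism)

HasCardinality : HeytingField f f₁ f₂ → ℕ → Set (f ⊔ f₁)
HasCardinality K q = Inverse (CommutativeRing.setoid (fieldRing K)) (≡.setoid (Fin q))

record FractionField (A : CommutativeRing c ℓ) (f f₁ f₂ : Level)
       : Set (c ⊔ ℓ ⊔ Level.suc (f ⊔ f₁ ⊔ f₂)) where
  field
    fractions : HeytingField f f₁ f₂

  private module A = CommutativeRing A
  open HeytingField fractions

  field
    ι          : A.Carrier → Carrier
    ι-mono     : IsMonomorphism A (fieldRing fractions) ι
    nonzero⇒#0 : ∀ {a} → ¬ (a A.≈ A.0#) → ι a # 0#
    fraction   : ∀ x → ∃₂ λ a b → (ι b # 0#) × (x * ι b ≈ ι a)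

record AlgebraicClosure (F : HeytingField f f₁ f₂) (o o₁ o₂ : Level)
       : Set (f ⊔ f₁ ⊔ f₂ ⊔ Level.suc (o ⊔ o₁ ⊔ o₂)) where
  field
    closure : HeytingField o o₁ o₂

  private
    module F  = HeytingField F
    module FX = Polynomial (fieldRing F)
  open HeytingField closure
  open Polynomial (fieldRing closure)

  field
    κ                   : F.Carrier → Carrier
    κ-homo              : IsHomomorphism (fieldRing F) (fieldRing closure) κ
    algebraicallyClosed : ∀ g → (∃ λ i → coeff g (suc i) # 0#) → ∃ λ x → eval g x ≈ 0#
    algebraic           : ∀ x → ∃ λ g → (∃ λ i → FX.coeff g i F.# F.0#)
                                      × (eval (map κ g) x ≈ 0#)

-- Polynomials in B and C over K, as polynomials in C over K[B].

K[B] : HeytingField c ℓ ℓ′ → CommutativeRing c ℓ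
K[B] K = polynomialRing (fieldRing K)

K[B,C] : HeytingField c ℓ ℓ′ → CommutativeRing c ℓ
K[B,C] K = polynomialRing (K[B] K)

module Bivariate (K : HeytingField c ℓ ℓ′) where

  private
    module K    = CommutativeRing (fieldRing K)
    module K[X] = Polynomial (fieldRing K)
    module K[Y] = Polynomial (K[B] K)

  open CommutativeRing (K[B,C] K) public
  open Exp semiring public using (_^_)
  open Mult semiring public using () renaming (_×_ to _·_)

  open Mult K.semiring using () renaming (_×_ to _×ᴷ_)

  constant : K.Carrier → Carrier
  constant a = K[Y].const (K[X].const a)

  B C : Carrier
  B = K[Y].const K[X].X
  C = K[Y].X

  𝒰 𝒱 : ℕ → Carrier
  𝒰 0             = 0#
  𝒰 1             = 1#
  𝒰 (suc (suc n)) = - B * 𝒰 (suc n) - C * 𝒰 n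
  𝒱 0             = 2 · 1#
  𝒱 1             = - B
  𝒱 (suc (suc n)) = - B * 𝒱 (suc n) - C * 𝒱 n

  fromℤ : ℤ → K.Carrier
  fromℤ (+ n)    = n ×ᴷ K.1#
  fromℤ -[1+ n ] = K.- (suc n ×ᴷ K.1#)

  Φ-over-K : ℕ → List K.Carrier
  Φ-over-K n = map fromℤ (Φ n)

module LucasAtoms
  (K : HeytingField c ℓ ℓ′)
  (F : FractionField (K[B,C] K) f f₁ f₂)
  (Ω : AlgebraicClosure (FractionField.fractions F) o o₁ o₂)
  where

  private
    module F    = HeytingField (FractionField.fractions F)
    module BC   = Bivariate K
  open FractionField F using (ι; nonzero⇒#0)
  open AlgebraicClosure Ω using (closure; κ; κ-homo)
  open HeytingField closure
  open CommutativeRing (fieldRing closure) using (semiring; ring)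
  open Exp semiring using (_^_)
  open Polynomial (fieldRing closure) using (_≋_; _⊛_; eval; coeff-≈)
  open RingProperties ring using (-‿distribˡ-*; -‿distribʳ-*; -‿involutive; -0#≈0#)
  open SetoidReasoning setoid

  embed : BC.Carrier → Carrier
  embed = κ ∘ ι

  _/_[_] : ∀ x y → y # 0# → Carrier
  x / y [ y#0 ] = x * proj₁ (#⇒invertible y#0)

  -- T² + B T + C = (T - α) (T - β)
  AreRoots : (α β : Carrier) → Set o₁
  AreRoots α β = embed BC.C ∷ embed BC.B ∷ 1# ∷ [] ≋ (- α ∷ 1# ∷ []) ⊛ (- β ∷ 1# ∷ [])

  private
    x-0≈x : ∀ x → x - 0# ≈ x
    x-0≈x x = trans (+-congˡ -0#≈0#) (+-identityʳ x)

  C≈αβ : ∀ {α β} → AreRoots α β → embed BC.C ≈ α * β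
  C≈αβ {α} {β} roots = begin
    embed BC.C         ≈⟨ coeff-≈ roots 0 ⟩
    - α * - β + 0#     ≈⟨ +-identityʳ _ ⟩
    - α * - β          ≈⟨ -‿distribˡ-* α (- β) ⟨
    - (α * - β)        ≈⟨ -‿cong (-‿distribʳ-* α β) ⟨
    - - (α * β)        ≈⟨ -‿involutive _ ⟩
    α * β              ∎

  C≉0 : ¬ (BC.C BC.≈ BC.0#)
  C≉0 C≈0 = K.#-irrefl (K.sym 1≈0)
    (K.invertible⇒# (K.1# , 1-0-inverseˡ , K.trans (K.*-comm _ _) 1-0-inverseˡ))
    where
    module K   = HeytingField K
    module K[X] = Polynomial (fieldRing K)
    module K[Y] = Polynomial (K[B] K)
    1≈0 : K.1# K.≈ K.0#
    1≈0 = K[X].coeff-≈ (K[Y].coeff-≈ C≈0 1) 0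
    1-0-inverseˡ : K.1# K.* (K.0# K.- K.1#) K.≈ K.1#
    1-0-inverseˡ = K.trans (K.*-congʳ 1≈0) (K.trans (K.zeroˡ _) (K.sym 1≈0))

  β#0 : ∀ {α β} → AreRoots α β → β # 0#
  β#0 {α} {β} roots =
    invertible⇒# (α * κ d , inverseˡ , trans (*-comm _ _) inverseˡ)
    where
    module κ = IsHomomorphism (fieldRing (FractionField.fractions F)) (fieldRing closure) κ-homo
    C-invertible = F.#⇒invertible (nonzero⇒#0 C≉0)
    d = proj₁ C-invertible
    inverseˡ : (α * κ d) * (β - 0#) ≈ 1#
    inverseˡ = begin
      (α * κ d) * (β - 0#)        ≈⟨ *-cong (*-comm _ _) (x-0≈x β) ⟩
      (κ d * α) * β               ≈⟨ *-assoc _ _ _ ⟩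
      κ d * (α * β)               ≈⟨ *-congˡ (C≈αβ roots) ⟨
      κ d * κ (ι BC.C)            ≈⟨ κ.*-homo _ _ ⟨
      κ (d F.* ι BC.C)            ≈⟨ κ.⟦⟧-cong (F.*-congˡ (F.trans (F.+-congˡ F-0) (F.+-identityʳ _))) ⟨
      κ (d F.* (ι BC.C F.- F.0#)) ≈⟨ κ.⟦⟧-cong (proj₁ (proj₂ C-invertible)) ⟩
      κ F.1#                      ≈⟨ κ.1#-homo ⟩
      1#                          ∎
      where
      F-0 : F.- F.0# F.≈ F.0#
      F-0 = RingProperties.-0#≈0# (CommutativeRing.ring (fieldRing (FractionField.fractions F)))

  Φʰᵒᵐ : ∀ {α β} → AreRoots α β → ℕ → Carrier
  Φʰᵒᵐ {α} {β} roots n =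
    β ^ φ n * eval (map (embed ∘ BC.constant) (BC.Φ-over-K n)) (α / β [ β#0 roots ])

  -- P is the n-th Lucas atom; embed is injective, so there is at most one such P.
  IsLucasAtom : ∀ {α β} → AreRoots α β → ℕ → BC.Carrier → Set (ℓ ⊔ o₁)
  IsLucasAtom roots n P =
      (n ≡ 1 → P BC.≈ BC.1#)
    × (2 ≤ n → embed P ≈ Φʰᵒᵐ roots n)

{-# OPTIONS --safe #-}
module Submission where

-- In characteristic p, X^(mp) - 1 = (X^m - 1)^p.  Factor both sides into cyclotomic polynomials:
-- the divisors of m p are the d p with d ∣ m and the divisors of m prime to p, so strong induction
-- and cancellation give Φ_(mp) Φ_m = Φ_m^p if p ∤ m and Φ_(mp) = Φ_m^p if p ∣ m.  The totient
-- satisfies the additive form of the same recursion, whence Φ_n = Φ_n′^φ(p^a), φ(n) = φ(p^a) φ(n′),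
-- and (1) by homogenization.  The factorization of X^n - 1 holds over ℤ: for e < d a positive integer
-- lies in the ideal (Φ_d, Φ_e), so the product of the Φ_d divides a multiple of X^n - 1 by an integer,
-- and being monic it divides X^n - 1 itself.
--
-- (2) and (3) follow from 𝒱_n = α^n + β^n and (α - β) 𝒰_n = α^n - β^n in K[B,C][T] / (T² + B T + C)
-- by applying Frobenius, where (α - β)² = B² - 4C, and α - β = B if p = 2.
--
-- In a field with q = p^e elements, q · 1 = 0 since translation by 1 permutes the elements, and
-- p · 1 = 0 since there are no nilpotents.

open import Level using (Level; _⊔_)
open import Algebra.Apartness.Bundles using (HeytingField)
open import Algebra.Bundles using (CommutativeMonoid; CommutativeRing)
import Algebra.Morphism.Construct.Composition as Composition
import Algebra.Properties.AbelianGroup as AbelianGroupProperties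
import Algebra.Properties.CommutativeMonoid.Mult as MonoidMult
import Algebra.Properties.CommutativeSemigroup as CommutativeSemigroupProperties
import Algebra.Properties.CommutativeSemigroup.Divisibility as SemigroupDivisibility
import Algebra.Properties.CommutativeSemiring.Binomial as Binomial
import Algebra.Properties.CommutativeSemiring.Exp as CommutativeExp
import Algebra.Properties.Group as GroupProperties
import Algebra.Properties.Monoid.Divisibility as MonoidDivisibility
import Algebra.Properties.Ring as RingProperties
import Algebra.Properties.Semiring.Mult as Mult
import Algebra.Properties.Semiring.Sum as Sum
import Algebra.Solver.Ring as RingSolver
open import Algebra.Solver.Ring.AlmostCommutativeRing
  using (fromCommutativeRing; _-Raw-AlmostCommutative⟶_)
open import Data.Bool using (true; false; if_then_else_)
open import Data.Fin as Fin using (Fin; toℕ)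
open import Data.Fin.Permutation using (permutation; _⟨$⟩ʳ_)
import Data.Fin.Properties as Fin
open import Data.Integer as ℤ using (ℤ; 0ℤ; +_; -[1+_]; _⊖_)
import Data.Integer.Properties as ℤ
open import Data.List using ([]; _∷_; _++_; filter; length; map; upTo)
import Data.List.Properties as List
open import Data.List.Relation.Unary.All using (All; all?; []; _∷_)
open import Data.Maybe using (Maybe; just; nothing)
open import Data.Nat as ℕ using (ℕ; zero; suc; _≤_; _<_; s≤s; z≤n; _∸_; _/_; _!)
import Data.Nat.Combinatorics as ℕ
open import Data.Nat.Coprimality as Coprimality using (Coprime; coprime?; gcd≡1⇒coprime)
open import Data.Nat.Divisibility as ℕ using (_∣_; _∤_; _∣?_; divides)
open import Data.Nat.DivMod using (m/n*n≡m; m≡m%n+[m/n]*n; m%n<n)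
open import Data.Nat.GCD using (gcd; gcd-GCD; gcd[m,n]∣m; gcd[m,n]∣n; gcd[m,n]≢0; module Bézout)
open import Data.Nat.Induction using (<-rec)
open import Data.Nat.Primality
  using (Prime; euclidsLemma; prime[2]; prime⇒irreducible; prime⇒nonTrivial; prime⇒nonZero; ¬prime[0])
import Data.Nat.Properties as ℕ
open import Data.Product using (_×_; _,_; proj₁; proj₂; ∃; ∃₂)
open import Data.Sum using (_⊎_; inj₁; inj₂)
open import Function using (_∘_)
open import Function.Bundles using (Inverse)
open import Relation.Binary.Definitions using (tri<; tri≈; tri>)
open import Relation.Binary.PropositionalEquality as ≡ using (_≡_; _≢_)
import Relation.Binary.Reasoning.Setoid as SetoidReasoning
open import Relation.Nullary using (Dec; yes; no; does; ¬_; contradiction)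
open import Relation.Unary using (Decidable)
open import Defs

-- `Φ` is defined by a division whose remainder is dropped, so nothing is known about it, not even
-- that it is monic, until that division is shown to be exact. The integer in the ideal (Φ_d, Φ_e)
-- is the value of 1 + Y + ... + Y^(s-1) at Y = 1, where Y = X^g, g = gcd(d, e) and s = d / g. Monic
-- polynomials carry the argument because they can be cancelled over every commutative ring and stay
-- monic under reduction modulo p.
--
-- The quadratic extension supplies two roots for (2) and (3) without a fraction field or an
-- algebraic closure. There α - β = B + 2 T has the constant term B, which suffices to cancel it
-- from multiples by elements of K[B,C], whatever p is.
--
-- In (1) the index n′ = 1 is exceptional: Λ_1 is 1 by convention, whereas Φ_1 homogenizes to α - β,
-- and Λ_(p^a) = (α - β)^φ(p^a) for a > 0. Hence (1) carries the condition that n′ = 1 forces a = 0.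

private variable
  c ℓ ℓ′ f f₁ f₂ o o₁ o₂ : Level
  P Q : Set

-- The homomorphism from ℤ to a commutative ring, and the ring solver over it

module IntegerCoefficients (R : CommutativeRing c ℓ) where
  open CommutativeRing R
  open RingProperties ring
  open GroupProperties +-group using (⁻¹-involutive)
  open AbelianGroupProperties +-abelianGroup using (⁻¹-∙-comm)
  open CommutativeSemigroupProperties +-commutativeSemigroup using (interchange)
  open Mult semiring using (×-homo-+; ×1-homo-*) renaming (_×_ to _·_)
  open SetoidReasoning setoid

  fromℤ : ℤ → Carrier
  fromℤ (+ n)    = n · 1#
  fromℤ -[1+ n ] = - (suc n · 1#)

  fromℤ-⊖ : ∀ m n → fromℤ (m ⊖ n) ≈ m · 1# - n · 1#
  fromℤ-⊖ m       zero    = sym (trans (+-congˡ -0#≈0#) (+-identityʳ _))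
  fromℤ-⊖ zero    (suc n) = sym (+-identityˡ _)
  fromℤ-⊖ (suc m) (suc n) = begin
    fromℤ (suc m ⊖ suc n)                   ≡⟨ ≡.cong fromℤ (ℤ.[1+m]⊖[1+n]≡m⊖n m n) ⟩
    fromℤ (m ⊖ n)                           ≈⟨ fromℤ-⊖ m n ⟩
    m · 1# - n · 1#                         ≈⟨ +-identityˡ _ ⟨
    0# + (m · 1# - n · 1#)                  ≈⟨ +-congʳ (-‿inverseʳ 1#) ⟨
    (1# - 1#) + (m · 1# - n · 1#)           ≈⟨ interchange _ _ _ _ ⟩
    (1# + m · 1#) + (- 1# - n · 1#)         ≈⟨ +-congˡ (⁻¹-∙-comm _ _) ⟩
    suc m · 1# - suc n · 1#                 ∎

  fromℤ-+ : ∀ i j → fromℤ (i ℤ.+ j) ≈ fromℤ i + fromℤ j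
  fromℤ-+ (+ m)    (+ n)    = ×-homo-+ 1# m n
  fromℤ-+ (+ m)    -[1+ n ] = fromℤ-⊖ m (suc n)
  fromℤ-+ -[1+ m ] (+ n)    = trans (fromℤ-⊖ n (suc m)) (+-comm _ _)
  fromℤ-+ -[1+ m ] -[1+ n ] = begin
    - (suc (suc m ℕ.+ n) · 1#)       ≡⟨ ≡.cong (λ k → - (k · 1#)) (≡.cong suc (≡.sym (ℕ.+-suc m n))) ⟩
    - ((suc m ℕ.+ suc n) · 1#)       ≈⟨ -‿cong (×-homo-+ 1# (suc m) (suc n)) ⟩
    - (suc m · 1# + suc n · 1#)      ≈⟨ ⁻¹-∙-comm _ _ ⟨
    - (suc m · 1#) - (suc n · 1#)    ∎

  fromℤ-neg : ∀ i → fromℤ (ℤ.- i) ≈ - fromℤ i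
  fromℤ-neg (+ zero)  = sym -0#≈0#
  fromℤ-neg (+ suc n) = refl
  fromℤ-neg -[1+ n ]  = sym (⁻¹-involutive _)

  fromℤ-*-+ : ∀ i n → fromℤ (i ℤ.* + n) ≈ fromℤ i * fromℤ (+ n)
  fromℤ-*-+ (+ m)    n = trans (reflexive (≡.cong fromℤ (≡.sym (ℤ.pos-* m n)))) (×1-homo-* m n)
  fromℤ-*-+ -[1+ m ] n = begin
    fromℤ (-[1+ m ] ℤ.* + n)        ≡⟨ ≡.cong fromℤ (ℤ.neg-distribˡ-* (+ suc m) (+ n)) ⟨
    fromℤ (ℤ.- (+ suc m ℤ.* + n))   ≈⟨ fromℤ-neg (+ suc m ℤ.* + n) ⟩
    - fromℤ (+ suc m ℤ.* + n)       ≈⟨ -‿cong (fromℤ-*-+ (+ suc m) n) ⟩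
    - (fromℤ (+ suc m) * (n · 1#))  ≈⟨ -‿distribˡ-* _ _ ⟩
    fromℤ -[1+ m ] * (n · 1#)       ∎

  fromℤ-* : ∀ i j → fromℤ (i ℤ.* j) ≈ fromℤ i * fromℤ j
  fromℤ-* i (+ n)    = fromℤ-*-+ i n
  fromℤ-* i -[1+ n ] = begin
    fromℤ (i ℤ.* -[1+ n ])          ≡⟨ ≡.cong fromℤ (ℤ.neg-distribʳ-* i (+ suc n)) ⟨
    fromℤ (ℤ.- (i ℤ.* + suc n))     ≈⟨ fromℤ-neg (i ℤ.* + suc n) ⟩
    - fromℤ (i ℤ.* + suc n)         ≈⟨ -‿cong (fromℤ-*-+ i (suc n)) ⟩
    - (fromℤ i * (suc n · 1#))      ≈⟨ -‿distribʳ-* _ _ ⟩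
    fromℤ i * fromℤ -[1+ n ]        ∎

  -- `fromℤ (+ 1)` unfolds to `1# + 0#` rather than to `1#`. For this reason identities that contain
  -- `1#` are solved below with a variable `o` in its place, while `con 0ℤ` does stand for `0#`.
  fromℤ-1 : fromℤ (+ 1) ≈ 1#
  fromℤ-1 = +-identityʳ 1#

  fromℤ-homo : IsHomomorphism ℤ.+-*-commutativeRing R fromℤ
  fromℤ-homo = record
    { isSemiringHomomorphism = record
      { isNearSemiringHomomorphism = record
        { +-isMonoidHomomorphism = record
          { isMagmaHomomorphism = record
            { isRelHomomorphism = record { cong = λ { ≡.refl → refl } }
            ; homo = fromℤ-+
            }
          ; ε-homo = refl
          }
        ; *-homo = fromℤ-*
        }
      ; 1#-homo = fromℤ-1
      }
    ; -‿homo = fromℤ-neg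
    }

  private
    coefficients : ℤ.+-*-rawRing -Raw-AlmostCommutative⟶ fromCommutativeRing R
    coefficients = record
      { ⟦_⟧ = fromℤ ; +-homo = fromℤ-+ ; *-homo = fromℤ-* ; -‿homo = fromℤ-neg
      ; 0-homo = refl ; 1-homo = fromℤ-1 }

    fromℤ-≟ : ∀ i j → Maybe (fromℤ i ≈ fromℤ j)
    fromℤ-≟ i j with i ℤ.≟ j
    ... | yes ≡.refl = just refl
    ... | no _       = nothing

  open RingSolver ℤ.+-*-rawRing (fromCommutativeRing R) coefficients fromℤ-≟ public
    using (solve; _:=_; _:+_; _:*_; _:-_; :-_; con)

-- Division by monic polynomials

-- Polynomial division and ideals

module PolynomialDivision (R : CommutativeRing c ℓ) where
  open CommutativeRing R
  open Polynomial R
  open IntegerCoefficients R using (solve; _:=_; _:+_; _:-_)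
  private module P = CommutativeRing (polynomialRing)
  open CommutativeExp P.commutativeSemiring using (_^_)

  -- Lists may end in zeros and equality in R need not be decidable, so the degree is not computed
  -- from f; k is only an upper bound, and a may vanish.
  Leading : Poly → ℕ → Carrier → Set ℓ
  Leading f k a = coeff f k ≈ a × (∀ i → k < i → coeff f i ≈ 0#)

  Monic : Poly → ℕ → Set ℓ
  Monic f k = Leading f k 1#

  coeff-∷⊛-zero : ∀ a p q → coeff ((a ∷ p) ⊛ q) 0 ≈ a * coeff q 0
  coeff-∷⊛-zero a p q =
    trans (coeff-⊕ (a ⊙ q) _ 0) (trans (+-identityʳ _) (coeff-⊙ a q 0))

  coeff-∷⊛-suc : ∀ a p q i →
    coeff ((a ∷ p) ⊛ q) (suc i) ≈ a * coeff q (suc i) + coeff (p ⊛ q) i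
  coeff-∷⊛-suc a p q i =
    trans (coeff-⊕ (a ⊙ q) _ (suc i)) (+-congʳ (coeff-⊙ a q (suc i)))

  coeff-const⊛ : ∀ a q i → coeff (const a ⊛ q) i ≈ a * coeff q i
  coeff-const⊛ a q zero    = coeff-∷⊛-zero a [] q
  coeff-const⊛ a q (suc i) = trans (coeff-∷⊛-suc a [] q i) (+-identityʳ _)

  Leading-resp : ∀ {f g k a b} → f ≋ g → a ≈ b → Leading f k a → Leading g k b
  Leading-resp f≋g a≈b (top , above) =
    trans (sym (coeff-≈ f≋g _)) (trans top a≈b) ,
    λ i k<i → trans (sym (coeff-≈ f≋g i)) (above i k<i)

  Leading-⊛ : ∀ {f g k m a b} → Leading f k a → Leading g m b → Leading (f ⊛ g) (k ℕ.+ m) (a * b)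
  Leading-⊛ {[]} (top , _) _ = trans (sym (zeroˡ _)) (*-congʳ top) , λ _ _ → refl
  Leading-⊛ {x ∷ f} {g} {zero} {m} (top , above) (top′ , above′) =
    trans (scaled m) (*-cong top top′) ,
    λ i m<i → trans (scaled i) (trans (*-congˡ (above′ i m<i)) (zeroʳ x))
    where
    scaled : ∀ i → coeff ((x ∷ f) ⊛ g) i ≈ x * coeff g i
    scaled zero    = coeff-∷⊛-zero x f g
    scaled (suc i) = trans (coeff-∷⊛-suc x f g i)
      (trans (+-congˡ (coeff-≈ (⊛-zeroˡ {f} g (coeffwise λ j → above (suc j) ℕ.z<s)) i))
             (+-identityʳ _))
  Leading-⊛ {x ∷ f} {g} {suc k} {m} (top , above) lead-g@(top′ , above′) =
    trans (shifted (k ℕ.+ m) (ℕ.m≤n+m m k)) (proj₁ lead-fg) ,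
    λ { (suc i) (s≤s k+m<i) →
        trans (shifted i (ℕ.≤-trans (ℕ.m≤n+m m k) (ℕ.<⇒≤ k+m<i))) (proj₂ lead-fg i k+m<i) }
    where
    lead-fg = Leading-⊛ {f} {g} (top , λ i k<i → above (suc i) (s≤s k<i)) lead-g
    -- Above degree m the constant term x contributes nothing to the product.
    shifted : ∀ i → m ≤ i → coeff ((x ∷ f) ⊛ g) (suc i) ≈ coeff (f ⊛ g) i
    shifted i m≤i = trans (coeff-∷⊛-suc x f g i)
      (trans (+-congʳ (trans (*-congˡ (above′ (suc i) (s≤s m≤i))) (zeroʳ x))) (+-identityˡ _))

  Monic-⊛ : ∀ {f g k m} → Monic f k → Monic g m → Monic (f ⊛ g) (k ℕ.+ m)
  Monic-⊛ {f} {g} mf mg = Leading-resp {f ⊛ g} ≋-refl (*-identityˡ 1#) (Leading-⊛ {f} {g} mf mg)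

  Monic-1 : Monic (const 1#) 0
  Monic-1 = refl , λ { (suc i) _ → refl }

  Monic-X : Monic X 1
  Monic-X = refl , λ { (suc zero) (s≤s ()) ; (suc (suc i)) _ → refl }

  Monic-Xⁿ : ∀ n → Monic (X ^ n) n
  Monic-Xⁿ zero    = Monic-1
  Monic-Xⁿ (suc n) = Monic-⊛ {X} {X ^ n} Monic-X (Monic-Xⁿ n)

  Monic-Xⁿ-1 : ∀ n → Monic (X ^ suc n P.- P.1#) (suc n)
  Monic-Xⁿ-1 n = trans (same n) (proj₁ (Monic-Xⁿ (suc n))) ,
    λ { (suc i) n<i → trans (same i) (proj₂ (Monic-Xⁿ (suc n)) (suc i) n<i) }
    where
    same : ∀ i → coeff (X ^ suc n P.- P.1#) (suc i) ≈ coeff (X ^ suc n) (suc i)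
    same i = trans (coeff-⊕ (X ^ suc n) (⊖ const 1#) (suc i)) (+-identityʳ _)

  -- Source of both cancellation and uniqueness of the remainder. Above degree m the product (a + X
  -- h) g has the coefficients of X h g, so h vanishes by induction; what is left is a g, whose
  -- coefficient at m is a.
  Monic-⊛-small⇒0 : ∀ {g m} → Monic g m → ∀ h →
                    (∀ i → m ≤ i → coeff (h ⊛ g) i ≈ 0#) → h ≋ []
  Monic-⊛-small⇒0         _                     []      _     = ≋-refl
  Monic-⊛-small⇒0 {g} {m} monic@(top , above) (a ∷ h) small = 0∷-≋[] a≈0 h≋0
    where
    h≋0 : h ≋ []
    h≋0 = Monic-⊛-small⇒0 monic h λ i m≤i →
      trans (sym (trans (coeff-∷⊛-suc a h g i)
                        (trans (+-congʳ (trans (*-congˡ (above (suc i) (s≤s m≤i))) (zeroʳ a)))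
                               (+-identityˡ _))))
            (small (suc i) (ℕ.m≤n⇒m≤1+n m≤i))
    scaled : ∀ i → coeff ((a ∷ h) ⊛ g) i ≈ a * coeff g i
    scaled i = trans (coeff-≈ (⊛-congʳ {a ∷ h} {const a} g (∷-cong refl h≋0)) i)
                     (coeff-const⊛ a g i)
    a≈0 : a ≈ 0#
    a≈0 = trans (sym (trans (scaled m) (trans (*-congˡ top) (*-identityʳ a))))
                (small m ℕ.≤-refl)

  Monic-cancelʳ : ∀ {g m} → Monic g m → ∀ h h′ → h ⊛ g ≋ h′ ⊛ g → h ≋ h′
  Monic-cancelʳ {g} monic h h′ eq =
    GroupProperties.x∙y⁻¹≈ε⇒x≈y P.+-group h h′ (Monic-⊛-small⇒0 monic (h P.- h′) λ i _ → coeff-≈ vanishes i)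
    where
    vanishes : (h P.- h′) ⊛ g ≋ []
    vanishes = ≋-trans (RingProperties.[y-z]x≈yx-zx P.ring g h h′)
                       (GroupProperties.x≈y⇒x∙y⁻¹≈ε P.+-group eq)

  divModMonic-correct : ∀ {g m} → Monic g m → ∀ f →
    f ≋ proj₁ (divModMonic g m f) ⊛ g ⊕ proj₂ (divModMonic g m f)
  divModMonic-correct monic [] = ≋-refl
  divModMonic-correct {g} {m} monic (a ∷ f) .coeff-≈ i =
    sym (trans (coeff-⊕ ((e ∷ q) ⊛ g) ((a ∷ r) ⊕ ⊖ (e ⊙ g)) i)
        (trans (+-congˡ (trans (coeff-⊕ (a ∷ r) (⊖ (e ⊙ g)) i)
                 (+-congˡ (trans (coeff-⊖ (e ⊙ g) i) (-‿cong (coeff-⊙ e g i))))))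
        (pointwise i)))
    where
    q = proj₁ (divModMonic g m f)
    r = proj₂ (divModMonic g m f)
    e = coeff (a ∷ r) m
    pointwise : ∀ i →
      coeff ((e ∷ q) ⊛ g) i + (coeff (a ∷ r) i - e * coeff g i) ≈ coeff (a ∷ f) i
    pointwise zero    = trans (+-congʳ (coeff-∷⊛-zero e q g))
      (solve 2 (λ x y → x :+ (y :- x) := y) refl (e * coeff g 0) a)
    pointwise (suc i) = trans (+-congʳ (coeff-∷⊛-suc e q g i))
      (trans (solve 3 (λ x y z → (x :+ y) :+ (z :- x) := y :+ z) refl
                (e * coeff g (suc i)) (coeff (q ⊛ g) i) (coeff r i))
      (sym (trans (coeff-≈ (divModMonic-correct monic f) i) (coeff-⊕ (q ⊛ g) r i))))

  divModMonic-small : ∀ {g m} → Monic g m → ∀ f i → m ≤ i →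
    coeff (proj₂ (divModMonic g m f)) i ≈ 0#
  divModMonic-small monic [] i m≤i = refl
  divModMonic-small {g} {m} monic@(top , above) (a ∷ f) i m≤i =
    trans (coeff-⊕ (a ∷ r) (⊖ (e ⊙ g)) i)
    (trans (+-congˡ (trans (coeff-⊖ (e ⊙ g) i) (-‿cong (coeff-⊙ e g i)))) (pointwise i m≤i))
    where
    r = proj₂ (divModMonic g m f)
    e = coeff (a ∷ r) m
    pointwise : ∀ i → m ≤ i → coeff (a ∷ r) i - e * coeff g i ≈ 0#
    pointwise i m≤i with ℕ.m≤n⇒m<n∨m≡n m≤i
    ... | inj₂ ≡.refl = trans (+-congˡ (-‿cong (trans (*-congˡ top) (*-identityʳ e)))) (-‿inverseʳ e)
    pointwise (suc i) _ | inj₁ m<i@(s≤s m≤i′) =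
      trans (+-cong (divModMonic-small monic f i m≤i′)
                    (-‿cong (trans (*-congˡ (above (suc i) m<i)) (zeroʳ e))))
            (-‿inverseʳ 0#)

  -- Write f = q g + r. Then (h - a q) g = a r has degree below m, so h - a q = 0 and a r = 0, and a
  -- is regular. This is how an integer factor is removed from a divisibility by a monic polynomial.
  divModMonic-exact : ∀ {g m} → Monic g m → ∀ {a} → (∀ {x} → a * x ≈ 0# → x ≈ 0#) →
    ∀ f h → const a ⊛ f ≋ h ⊛ g → f ≋ proj₁ (divModMonic g m f) ⊛ g
  divModMonic-exact {g} {m} monic {a} regular f h af≋hg =
    ≋-trans correct (≋-trans (⊕-cong (≋-refl {q ⊛ g}) r≋0) (⊕-identityʳ (q ⊛ g)))
    where
    q = proj₁ (divModMonic g m f)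
    r = proj₂ (divModMonic g m f)
    correct = divModMonic-correct monic f
    ar : (h P.- const a ⊛ q) ⊛ g ≋ const a ⊛ r
    ar = ≋-trans (solveP 4 (λ h a q g → (h :-ᴾ a :*ᴾ q) :*ᴾ g :=ᴾ h :*ᴾ g :-ᴾ a :*ᴾ (q :*ᴾ g))
                     ≋-refl h (const a) q g)
         (≋-trans (P.+-congʳ (≋-trans (≋-sym af≋hg) (P.*-congˡ {const a} correct)))
         (solveP 3 (λ a b r → a :*ᴾ (b :+ᴾ r) :-ᴾ a :*ᴾ b :=ᴾ a :*ᴾ r) ≋-refl (const a) (q ⊛ g) r))
      where open IntegerCoefficients polynomialRing using () renaming
              (solve to solveP; _:=_ to _:=ᴾ_; _:+_ to _:+ᴾ_; _:*_ to _:*ᴾ_; _:-_ to _:-ᴾ_)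
    quotient≋0 : h P.- const a ⊛ q ≋ []
    quotient≋0 = Monic-⊛-small⇒0 monic _ λ i m≤i →
      trans (coeff-≈ ar i) (trans (coeff-const⊛ a r i)
        (trans (*-congˡ (divModMonic-small monic f i m≤i)) (zeroʳ a)))
    r≋0 : r ≋ []
    r≋0 .coeff-≈ i = regular (trans (sym (coeff-const⊛ a r i))
      (trans (sym (coeff-≈ ar i)) (coeff-≈ (⊛-zeroˡ {h P.- const a ⊛ q} g quotient≋0) i)))

-- Ideals with two generators, and the elements x^n - 1

module LinearCombinations (A : CommutativeRing c ℓ) where
  open CommutativeRing A
  open CommutativeExp commutativeSemiring
  open IntegerCoefficients A using (solve; _:=_; _:+_; _:*_; _:-_; :-_)
  open Mult semiring using () renaming (_×_ to _·_)
  open SetoidReasoning setoid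

  infix 4 _∈⟨_,_⟩

  _∈⟨_,_⟩ : Carrier → Carrier → Carrier → Set (c ⊔ ℓ)
  z ∈⟨ x , y ⟩ = ∃₂ λ u v → z ≈ u * x + v * y

  -- When the two combinations are multiplied out, every term except v v′ y z contains x.
  ∈-product : ∀ {a b x y z} → a ∈⟨ x , y ⟩ → b ∈⟨ x , z ⟩ → a * b ∈⟨ x , y * z ⟩
  ∈-product {a} {b} {x} {y} {z} (u , v , a≈) (u′ , v′ , b≈) =
    u * (u′ * x + v′ * z) + v * y * u′ , v * v′ ,
    trans (*-cong a≈ b≈)
      (solve 7 (λ u v u′ v′ x y z →
         (u :* x :+ v :* y) :* (u′ :* x :+ v′ :* z) :=
         (u :* (u′ :* x :+ v′ :* z) :+ v :* y :* u′) :* x :+ (v :* v′) :* (y :* z))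
       refl u v u′ v′ x y z)

  ∈-trans : ∀ {a x y z k} → a ∈⟨ x , y ⟩ → y ∈⟨ k * x , z ⟩ → a ∈⟨ x , z ⟩
  ∈-trans {a} {x} {y} {z} {k} (u , v , a≈) (u′ , v′ , y≈) = u + v * u′ * k , v * v′ , (begin
    a                                        ≈⟨ a≈ ⟩
    u * x + v * y                            ≈⟨ +-congˡ (trans (*-congˡ y≈) (distribˡ v _ _)) ⟩
    u * x + (v * (u′ * (k * x)) + v * (v′ * z))
      ≈⟨ +-congˡ (+-cong (trans (sym (*-assoc v u′ _)) (sym (*-assoc (v * u′) k x))) (sym (*-assoc v v′ z))) ⟩
    u * x + (v * u′ * k * x + v * v′ * z)    ≈⟨ +-assoc _ _ _ ⟨
    u * x + v * u′ * k * x + v * v′ * z      ≈⟨ +-congʳ (distribʳ x u _) ⟨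
    (u + v * u′ * k) * x + v * v′ * z        ∎)

  ∈-mono : ∀ {a x y k l x′ y′} → a ∈⟨ x , y ⟩ → x ≈ k * x′ → y ≈ l * y′ → a ∈⟨ x′ , y′ ⟩
  ∈-mono {k = k} {l} (u , v , a≈) x≈ y≈ = u * k , v * l ,
    trans a≈ (+-cong (trans (*-congˡ x≈) (sym (*-assoc u k _))) (trans (*-congˡ y≈) (sym (*-assoc v l _))))

  -- The usual argument for comaximal divisors with a in the place of 1: in u x f put f = l y, in v
  -- y f put f = k x, and both terms become multiples of x y.
  common-multiple : ∀ {a x y f k l} → a ∈⟨ x , y ⟩ → f ≈ k * x → f ≈ l * y →
                    ∃ λ h → a * f ≈ h * (x * y)
  common-multiple {a} {x} {y} {f} {k} {l} (u , v , a≈) f≈kx f≈ly = u * l + v * k , (begin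
    a * f                                ≈⟨ *-congʳ a≈ ⟩
    (u * x + v * y) * f                  ≈⟨ distribʳ _ _ _ ⟩
    u * x * f + v * y * f                ≈⟨ +-cong (*-congˡ f≈ly) (*-congˡ f≈kx) ⟩
    u * x * (l * y) + v * y * (k * x)
      ≈⟨ solve 6 (λ u v x y k l → u :* x :* (l :* y) :+ v :* y :* (k :* x) :=
                                  (u :* l :+ v :* k) :* (x :* y)) refl u v x y k l ⟩
    (u * l + v * k) * (x * y)            ∎)

  geometric : Carrier → ℕ → Carrier
  geometric x zero    = 0#
  geometric x (suc n) = 1# + x * geometric x n

  xⁿ-1 : ∀ x n → x ^ n - 1# ≈ geometric x n * (x - 1#)
  xⁿ-1 x zero    = trans (-‿inverseʳ 1#) (sym (zeroˡ _))
  xⁿ-1 x (suc n) = begin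
    x * x ^ n - 1#
      ≈⟨ solve 3 (λ x y o → x :* y :- o := (x :* o :- o) :+ x :* (y :- o)) refl x (x ^ n) 1# ⟩
    (x * 1# - 1#) + x * (x ^ n - 1#)
      ≈⟨ +-cong (+-congʳ (*-identityʳ x)) (trans (*-congˡ (xⁿ-1 x n)) (sym (*-assoc _ _ _))) ⟩
    (x - 1#) + x * geometric x n * (x - 1#)        ≈⟨ +-congʳ (*-identityˡ _) ⟨
    1# * (x - 1#) + x * geometric x n * (x - 1#)   ≈⟨ distribʳ _ _ _ ⟨
    (1# + x * geometric x n) * (x - 1#)            ∎

  -- The sum 1 + x + ... + x^(n-1) has the value n at x = 1.
  n∈⟨geometric,x-1⟩ : ∀ x n → n · 1# ∈⟨ geometric x n , x - 1# ⟩
  n∈⟨geometric,x-1⟩ x n =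
    let v , eq = cofactor n in 1# , v , trans eq (+-congʳ (sym (*-identityˡ _)))
    where
    cofactor : ∀ n → ∃ λ v → n · 1# ≈ geometric x n + v * (x - 1#)
    cofactor zero    = 0# , sym (trans (+-congˡ (zeroˡ _)) (+-identityˡ 0#))
    -- The sum for n + 1 contains x g instead of g, and g = x g - g (x - 1).
    cofactor (suc n) = let v , eq = cofactor n; g = geometric x n in v - g , (begin
      1# + n · 1#                               ≈⟨ +-congˡ eq ⟩
      1# + (g + v * (x - 1#))                   ≈⟨ +-congˡ (+-congʳ (*-identityʳ g)) ⟨
      1# + (g * 1# + v * (x - 1#))
        ≈⟨ solve 4 (λ x g v o → o :+ (g :* o :+ v :* (x :- o)) :=
                                (o :+ x :* g) :+ (v :- g) :* (x :- o)) refl x g v 1# ⟩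
      (1# + x * g) + (v - g) * (x - 1#)         ∎)

  xᵐⁿ-1 : ∀ x m n → ∃ λ h → x ^ (n ℕ.* m) - 1# ≈ h * (x ^ m - 1#)
  xᵐⁿ-1 x m n = geometric (x ^ m) n , (begin
    x ^ (n ℕ.* m) - 1#                ≡⟨ ≡.cong (λ k → x ^ k - 1#) (ℕ.*-comm n m) ⟩
    x ^ (m ℕ.* n) - 1#                ≈⟨ +-congʳ (^-assocʳ x m n) ⟨
    (x ^ m) ^ n - 1#                  ≈⟨ xⁿ-1 (x ^ m) n ⟩
    geometric (x ^ m) n * (x ^ m - 1#) ∎)

  -- Bézout in the exponents. Over ℕ the negative coefficient moves to the other side, which leaves
  -- two mirror cases: d + l n = k m and d + k m = l n.
  xᵍ-1∈⟨xᵐ-1,xⁿ-1⟩ : ∀ x m n → x ^ gcd m n - 1# ∈⟨ x ^ m - 1# , x ^ n - 1# ⟩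
  xᵍ-1∈⟨xᵐ-1,xⁿ-1⟩ x m n = from-Bézout (Bézout.identity (gcd-GCD m n))
    where
    d = gcd m n
    -- P - 1 = (P Q - 1) - P (Q - 1) with P = x ^ d and Q = x ^ (l n), so that P Q = x ^ (k m).
    balance : ∀ {m n} k l → d ℕ.+ l ℕ.* n ≡ k ℕ.* m → x ^ d - 1# ∈⟨ x ^ m - 1# , x ^ n - 1# ⟩
    balance {m} {n} k l eq =
      let h , PQ-1 = xᵐⁿ-1 x m k
          h′ , Q-1 = xᵐⁿ-1 x n l
      in h , - (x ^ d) * h′ , (begin
        x ^ d - 1#                                         ≈⟨ +-congʳ (*-identityʳ _) ⟨
        x ^ d * 1# - 1#
          ≈⟨ solve 3 (λ P Q o → P :* o :- o := (P :* Q :- o) :+ (:- P) :* (Q :- o))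
               refl (x ^ d) (x ^ (l ℕ.* n)) 1# ⟩
        (x ^ d * x ^ (l ℕ.* n) - 1#) + - (x ^ d) * (x ^ (l ℕ.* n) - 1#)
          ≈⟨ +-congʳ (+-congʳ (trans (sym (^-homo-* x d (l ℕ.* n))) (^-congʳ x eq))) ⟩
        (x ^ (k ℕ.* m) - 1#) + - (x ^ d) * (x ^ (l ℕ.* n) - 1#)
          ≈⟨ +-cong PQ-1 (trans (*-congˡ Q-1) (sym (*-assoc _ _ _))) ⟩
        h * (x ^ m - 1#) + - (x ^ d) * h′ * (x ^ n - 1#)   ∎)
    from-Bézout : Bézout.Identity d m n → x ^ d - 1# ∈⟨ x ^ m - 1# , x ^ n - 1# ⟩
    from-Bézout (Bézout.+- k l eq) = balance k l eq
    from-Bézout (Bézout.-+ k l eq) with balance l k eq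
    ... | u , v , e = v , u , trans e (+-comm _ _)

module _ where
  open CommutativeRing ℤ[X]
  open Polynomial ℤ.+-*-commutativeRing
    using (coeff; _≋_; coeffwise; coeff-≈; ⊛-zeroˡ; ≋-refl)
  open PolynomialDivision ℤ.+-*-commutativeRing

  -- Relies on the decidable equality of ℤ: trailing zeros are skipped to find the true leading
  -- coefficient.
  zero⊎leading : ∀ f → (f ≋ []) ⊎ (∃₂ λ k a → a ≢ 0ℤ × Leading f k a)
  zero⊎leading [] = inj₁ ≋-refl
  zero⊎leading (a ∷ f) with zero⊎leading f
  ... | inj₂ (k , b , b≢0 , top , above) =
    inj₂ (suc k , b , b≢0 , top , λ { (suc i) (s≤s k<i) → above i k<i })
  ... | inj₁ f≋0 with a ℤ.≟ 0ℤ
  ...   | yes a≡0 = inj₁ (coeffwise λ { zero → a≡0 ; (suc i) → coeff-≈ f≋0 i })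
  ...   | no  a≢0 = inj₂ (0 , a , a≢0 , ≡.refl , λ { (suc i) _ → coeff-≈ f≋0 i })

  Leading-unique : ∀ {f k m a b} → a ≢ 0ℤ → b ≢ 0ℤ → Leading f k a → Leading f m b → k ≡ m × a ≡ b
  Leading-unique {f} {k} {m} a≢0 b≢0 (top , above) (top′ , above′) with ℕ.<-cmp k m
  ... | tri< k<m _ _    = contradiction (≡.trans (≡.sym top′) (above m k<m)) b≢0
  ... | tri> _ _ m<k    = contradiction (≡.trans (≡.sym top) (above′ k m<k)) a≢0
  ... | tri≈ _ ≡.refl _ = ≡.refl , ≡.trans (≡.sym top) top′

  -- Leading coefficients multiply, so the one of f is 1. This yields the monicity of Φ n, which is
  -- known only as a quotient.
  Monic-factor : ∀ {f g h m n} → Monic g m → Monic h n → h ≈ f * g → ∃ (Monic f)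
  Monic-factor {f} {g} {h} {m} {n} mg mh h≈fg with zero⊎leading f
  ... | inj₁ f≋0 = contradiction
    (≡.trans (≡.sym (proj₁ mh)) (≡.trans (coeff-≈ h≈fg n) (coeff-≈ (⊛-zeroˡ {f} g f≋0) n))) λ ()
  ... | inj₂ (k , a , a≢0 , lead) with
        Leading-unique {h} (λ a1≡0 → a≢0 (≡.trans (≡.sym (ℤ.*-identityʳ a)) a1≡0)) (λ ())
          (Leading-resp (sym h≈fg) ≡.refl (Leading-⊛ {f} {g} lead mg)) mh
  ...   | _ , a1≡1 = k , Leading-resp {f} refl (≡.trans (≡.sym (ℤ.*-identityʳ a)) a1≡1) lead

  private
    All-zero⇒coeff : ∀ {f} → All (_≡ 0ℤ) f → ∀ i → coeff f i ≡ 0ℤ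
    All-zero⇒coeff []         i       = ≡.refl
    All-zero⇒coeff (a≡0 ∷ _)  zero    = a≡0
    All-zero⇒coeff (_ ∷ f≡0)  (suc i) = All-zero⇒coeff f≡0 i

    coeff⇒All-zero : ∀ f → (∀ i → coeff f i ≡ 0ℤ) → All (_≡ 0ℤ) f
    coeff⇒All-zero []      _  = []
    coeff⇒All-zero (a ∷ f) z = z 0 ∷ coeff⇒All-zero f (λ i → z (suc i))

  -- Links the number `degree g` that the definition of `Φ` hands to `divModMonic` with the degree
  -- recorded by `Monic`.
  degree-Monic : ∀ g {m} → Monic g m → degree g ≡ m
  degree-Monic []      (() , _)
  degree-Monic (a ∷ g) {m} (top , above) with all? (ℤ._≟ 0ℤ) g
  degree-Monic (a ∷ g) {zero}  _             | yes _ = ≡.refl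
  degree-Monic (a ∷ g) {suc m} (top , above) | yes g≡0 =
    contradiction (≡.trans (≡.sym top) (All-zero⇒coeff g≡0 m)) λ ()
  degree-Monic (a ∷ g) {zero}  (top , above) | no g≢0 =
    contradiction (coeff⇒All-zero g (λ i → above (suc i) ℕ.z<s)) g≢0
  degree-Monic (a ∷ g) {suc m} (top , above) | no g≢0 =
    ≡.cong suc (degree-Monic g (top , λ i m<i → above (suc i) (s≤s m<i)))

-- Products over divisors and Euler's totient

-- Used for multiplication of polynomials, where `n · x` is the power x^n, and for addition of
-- natural numbers, where it is n x. One recursion thus treats both cyclotomic polynomials and the
-- totient.
module RangeProduct (M : CommutativeMonoid c ℓ) where
  open import Data.Nat using (_+_; _*_)
  open CommutativeMonoid M
  open MonoidMult M using (×-distrib-+) renaming (_×_ to _·_)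
  open CommutativeSemigroupProperties commutativeSemigroup using (interchange)
  open SetoidReasoning setoid

  infixl 8 _when_ _unless_

  -- Branches on `does d` exactly as `∏Φ-divisors` does, so the factors of the two products coincide
  -- by computation.
  _when_ : Carrier → Dec P → Carrier
  x when d = if does d then x else ε

  _unless_ : Carrier → Dec P → Carrier
  x unless d = if does d then ε else x

  when-true : ∀ {x} (d : Dec P) → P → x when d ≈ x
  when-true (yes _) _ = refl
  when-true (no ¬p) p = contradiction p ¬p

  when-false : ∀ {x} (d : Dec P) → ¬ P → x when d ≈ ε
  when-false (yes p) ¬p = contradiction p ¬p
  when-false (no _)  _  = refl

  when-cong : ∀ {x y} (d : Dec P) (e : Dec Q) → (P → Q) → (Q → P) → (P → x ≈ y) → x when d ≈ y when e
  when-cong (yes p) e f _ x≈y = trans (x≈y p) (sym (when-true e (f p)))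
  when-cong (no ¬p) e _ g _   = sym (when-false e (λ q → ¬p (g q)))

  unless-true : ∀ {x} (d : Dec P) → P → x unless d ≈ ε
  unless-true (yes _) _ = refl
  unless-true (no ¬p) p = contradiction p ¬p

  unless-false : ∀ {x} (d : Dec P) → ¬ P → x unless d ≈ x
  unless-false (yes p) ¬p = contradiction p ¬p
  unless-false (no _)  _  = refl

  when-unless : ∀ x (d : Dec P) → x ≈ x when d ∙ x unless d
  when-unless x (yes _) = sym (identityʳ x)
  when-unless x (no _)  = sym (identityˡ x)

  when-distrib : ∀ x y (d : Dec P) → (x ∙ y) when d ≈ x when d ∙ y when d
  when-distrib x y (yes _) = refl
  when-distrib x y (no _)  = sym (identityˡ ε)

  ∏ : ℕ → (ℕ → Carrier) → Carrier
  ∏ zero    f = ε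
  ∏ (suc k) f = f (suc k) ∙ ∏ k f

  ∏-cong : ∀ k {f g} → (∀ i → 1 ≤ i → i ≤ k → f i ≈ g i) → ∏ k f ≈ ∏ k g
  ∏-cong zero    f≈g = refl
  ∏-cong (suc k) f≈g =
    ∙-cong (f≈g (suc k) (s≤s z≤n) ℕ.≤-refl) (∏-cong k λ i 1≤i i≤k → f≈g i 1≤i (ℕ.m≤n⇒m≤1+n i≤k))

  ∏-ε : ∀ k {f} → (∀ i → 1 ≤ i → i ≤ k → f i ≈ ε) → ∏ k f ≈ ε
  ∏-ε zero    f≈ε = refl
  ∏-ε (suc k) f≈ε = trans (∙-cong (f≈ε (suc k) (s≤s z≤n) ℕ.≤-refl)
    (∏-ε k λ i 1≤i i≤k → f≈ε i 1≤i (ℕ.m≤n⇒m≤1+n i≤k))) (identityˡ ε)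

  ∏-∙ : ∀ k f g → ∏ k (λ i → f i ∙ g i) ≈ ∏ k f ∙ ∏ k g
  ∏-∙ zero    f g = sym (identityˡ ε)
  ∏-∙ (suc k) f g = trans (∙-congˡ (∏-∙ k f g)) (interchange _ _ _ _)

  ∏-+ : ∀ k l f → ∏ (k + l) f ≈ ∏ k (λ i → f (i + l)) ∙ ∏ l f
  ∏-+ zero    l f = sym (identityˡ _)
  ∏-+ (suc k) l f = trans (∙-congˡ (∏-+ k l f)) (sym (assoc _ _ _))

  ∏-extend : ∀ {l k} → l ≤ k → ∀ f → (∀ i → l < i → f i ≈ ε) → ∏ k f ≈ ∏ l f
  ∏-extend {l} l≤k f f≈ε with ℕ.m≤n⇒∃[o]m+o≡n l≤k
  ... | o , ≡.refl = begin
    ∏ (l + o) f                        ≡⟨ ≡.cong (λ k → ∏ k f) (ℕ.+-comm l o) ⟩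
    ∏ (o + l) f                        ≈⟨ ∏-+ o l f ⟩
    ∏ o (λ i → f (i + l)) ∙ ∏ l f      ≈⟨ ∙-congʳ (∏-ε o λ i 1≤i _ → f≈ε (i + l) (ℕ.+-monoˡ-≤ l 1≤i)) ⟩
    ε ∙ ∏ l f                          ≈⟨ identityˡ _ ⟩
    ∏ l f                              ∎

  -- The range is cut into blocks of p consecutive indices; in each block only the top index is a
  -- multiple of p.
  ∏-multiples : ∀ {p} → 1 ≤ p → ∀ m f → (∀ i → p ∤ i → f i ≈ ε) → ∏ (m * p) f ≈ ∏ m (λ j → f (j * p))
  ∏-multiples         _   zero    f f≈ε = refl
  ∏-multiples {suc p} 1≤p (suc m) f f≈ε = begin
    ∏ (suc p + m * suc p) f
      ≈⟨ ∏-+ (suc p) (m * suc p) f ⟩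
    f (suc m * suc p) ∙ ∏ p (λ i → f (i + m * suc p)) ∙ ∏ (m * suc p) f
      ≈⟨ ∙-cong (∙-congˡ (∏-ε p λ i 1≤i i≤p → f≈ε (i + m * suc p) (indivisible 1≤i i≤p)))
                (∏-multiples 1≤p m f f≈ε) ⟩
    f (suc m * suc p) ∙ ε ∙ ∏ m (λ j → f (j * suc p))
      ≈⟨ ∙-congʳ (identityʳ _) ⟩
    f (suc m * suc p) ∙ ∏ m (λ j → f (j * suc p))  ∎
    where
    indivisible : ∀ {i} → 1 ≤ i → i ≤ p → suc p ∤ i + m * suc p
    indivisible {i} 1≤i i≤p p∣ = ℕ.>⇒∤ {{ℕ.>-nonZero 1≤i}} (s≤s i≤p)
      (ℕ.∣m+n∣m⇒∣n (≡.subst (suc p ∣_) (ℕ.+-comm i (m * suc p)) p∣) (divides m ≡.refl))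

  ∏-periodic : ∀ k m f → (∀ i → f (i + m) ≈ f i) → ∏ (k * m) f ≈ k · ∏ m f
  ∏-periodic zero    m f periodic = refl
  ∏-periodic (suc k) m f periodic = begin
    ∏ (m + k * m) f                            ≈⟨ ∏-+ m (k * m) f ⟩
    ∏ m (λ i → f (i + k * m)) ∙ ∏ (k * m) f
      ≈⟨ ∙-cong (∏-cong m λ i _ _ → shift k i) (∏-periodic k m f periodic) ⟩
    ∏ m f ∙ k · ∏ m f                          ∎
    where
    shift : ∀ k i → f (i + k * m) ≈ f i
    shift zero    i = reflexive (≡.cong f (ℕ.+-identityʳ i))
    shift (suc k) i = begin
      f (i + (m + k * m))   ≡⟨ ≡.cong (λ j → f (i + j)) (ℕ.+-comm m (k * m)) ⟩
      f (i + (k * m + m))   ≡⟨ ≡.cong f (≡.sym (ℕ.+-assoc i (k * m) m)) ⟩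
      f (i + k * m + m)     ≈⟨ periodic (i + k * m) ⟩
      f (i + k * m)         ≈⟨ shift k i ⟩
      f i                   ∎

  ·-ε : ∀ n → n · ε ≈ ε
  ·-ε zero    = refl
  ·-ε (suc n) = trans (identityˡ _) (·-ε n)

  ∏-· : ∀ n k f → ∏ k (λ i → n · f i) ≈ n · ∏ k f
  ∏-· n zero    f = sym (·-ε n)
  ∏-· n (suc k) f = trans (∙-congˡ (∏-· n k f)) (sym (×-distrib-+ _ _ n))

  when-· : ∀ n x (d : Dec P) → (n · x) when d ≈ n · (x when d)
  when-· n x (yes _) = refl
  when-· n x (no _)  = sym (·-ε n)

  ∏∣≤ : ℕ → ℕ → (ℕ → Carrier) → Carrier
  ∏∣≤ n k f = ∏ k (λ d → f d when (d ∣? n))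

  ∏∣ : ℕ → (ℕ → Carrier) → Carrier
  ∏∣ n = ∏∣≤ n n

  Cancellable : Carrier → Set (c ⊔ ℓ)
  Cancellable x = ∀ y z → y ∙ x ≈ z ∙ x → y ≈ z

  Cancellable-ε : Cancellable ε
  Cancellable-ε y z eq = trans (sym (identityʳ y)) (trans eq (identityʳ z))

  Cancellable-∙ : ∀ {x y} → Cancellable x → Cancellable y → Cancellable (x ∙ y)
  Cancellable-∙ {x} {y} cx cy u v eq =
    cx u v (cy (u ∙ x) (v ∙ x) (trans (assoc u x y) (trans eq (sym (assoc v x y)))))

  Cancellable-when : ∀ {x} (d : Dec P) → Cancellable x → Cancellable (x when d)
  Cancellable-when (yes _) cx = cx
  Cancellable-when (no _)  _  = Cancellable-ε

  Cancellable-· : ∀ {x} n → Cancellable x → Cancellable (n · x)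
  Cancellable-· zero    cx = Cancellable-ε
  Cancellable-· (suc n) cx = Cancellable-∙ cx (Cancellable-· n cx)

  Cancellable-∏ : ∀ k {f} → (∀ i → 1 ≤ i → Cancellable (f i)) → Cancellable (∏ k f)
  Cancellable-∏ zero    cf = Cancellable-ε
  Cancellable-∏ (suc k) cf = Cancellable-∙ (cf (suc k) (s≤s z≤n)) (Cancellable-∏ k cf)

  -- Takes the place of Möbius inversion where there are no inverses: strong induction equates the
  -- factors at all proper divisors, and their product is cancelled.
  ∏∣-injective : ∀ {f g} → (∀ d → 1 ≤ d → Cancellable (g d)) →
                 (∀ n → 1 ≤ n → ∏∣ n f ≈ ∏∣ n g) → ∀ n → 1 ≤ n → f n ≈ g n
  ∏∣-injective {f} {g} cg eq = <-rec (λ n → 1 ≤ n → f n ≈ g n) step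
    where
    step : ∀ n → (∀ {d} → d < n → 1 ≤ d → f d ≈ g d) → 1 ≤ n → f n ≈ g n
    step (suc n) rec 1≤n =
      Cancellable-∏ n (λ d 1≤d → Cancellable-when (d ∣? suc n) (cg d 1≤d)) (f (suc n)) (g (suc n)) (begin
        f (suc n) ∙ ∏ n (λ d → g d when (d ∣? suc n))
          ≈⟨ ∙-cong (when-true (suc n ∣? suc n) ℕ.∣-refl)
                    (∏-cong n λ d 1≤d d≤n → when-cong (d ∣? suc n) (d ∣? suc n) (λ z → z) (λ z → z)
                                              (λ _ → rec (s≤s d≤n) 1≤d)) ⟨
        ∏∣ (suc n) f
          ≈⟨ eq (suc n) 1≤n ⟩
        ∏∣ (suc n) g
          ≈⟨ ∙-congʳ (when-true (suc n ∣? suc n) ℕ.∣-refl) ⟩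
        g (suc n) ∙ ∏ n (λ d → g d when (d ∣? suc n))   ∎)

  module _ {p : ℕ} (p-prime : Prime p) where
    private
      instance
        p≢0 : ℕ.NonZero p
        p≢0 = prime⇒nonZero p-prime

      1≤p : 1 ≤ p
      1≤p = ℕ.>-nonZero⁻¹ p

    p∤⇒coprime : ∀ {d} → p ∤ d → Coprime d p
    p∤⇒coprime p∤d (e∣d , e∣p) with prime⇒irreducible p-prime e∣p
    ... | inj₁ e≡1    = e≡1
    ... | inj₂ ≡.refl = contradiction e∣d p∤d

    -- The divisors of m p are the d p with d ∣ m and the divisors of m prime to p.
    ∏∣-*p : ∀ m → 1 ≤ m → ∀ f →
      ∏∣ (m * p) f ≈ ∏∣ m (λ d → f (d * p) ∙ f d unless (p ∣? d))
    ∏∣-*p m 1≤m f = begin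
      ∏ (m * p) F
        ≈⟨ ∏-cong (m * p) (λ i _ _ → when-unless (F i) (p ∣? i)) ⟩
      ∏ (m * p) (λ i → F i when (p ∣? i) ∙ F i unless (p ∣? i))
        ≈⟨ ∏-∙ (m * p) _ _ ⟩
      ∏ (m * p) (λ i → F i when (p ∣? i)) ∙ ∏ (m * p) (λ i → F i unless (p ∣? i))
        ≈⟨ ∙-cong divisible indivisible ⟩
      ∏∣ m (λ d → f (d * p)) ∙ ∏∣ m (λ d → f d unless (p ∣? d))
        ≈⟨ ∏-∙ m _ _ ⟨
      ∏ m (λ d → f (d * p) when (d ∣? m) ∙ f d unless (p ∣? d) when (d ∣? m))
        ≈⟨ ∏-cong m (λ d _ _ → when-distrib _ _ (d ∣? m)) ⟨
      ∏∣ m (λ d → f (d * p) ∙ f d unless (p ∣? d))  ∎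
      where
      F : ℕ → Carrier
      F i = f i when (i ∣? m * p)
      divisible : ∏ (m * p) (λ i → F i when (p ∣? i)) ≈ ∏∣ m (λ d → f (d * p))
      divisible = trans (∏-multiples 1≤p m _ (λ i → when-false (p ∣? i)))
        (∏-cong m λ d _ _ → trans (when-true (p ∣? d * p) (divides d ≡.refl))
          (when-cong (d * p ∣? m * p) (d ∣? m) (ℕ.*-cancelʳ-∣ p) (ℕ.*-monoˡ-∣ p) (λ _ → refl)))
      swap : ∀ i (b : Dec (p ∣ i)) → F i unless b ≈ f i unless b when (i ∣? m)
      swap i (yes p∣i) = sym (helper (i ∣? m))
        where
        helper : (d : Dec (i ∣ m)) → ε when d ≈ ε
        helper (yes _) = refl
        helper (no _)  = refl
      -- An index prime to p divides m p exactly if it divides m.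
      swap i (no p∤i) = when-cong (i ∣? m * p) (i ∣? m)
        (λ i∣mp → Coprimality.coprime-divisor (p∤⇒coprime p∤i) (≡.subst (i ∣_) (ℕ.*-comm m p) i∣mp))
        (ℕ.∣m⇒∣m*n p) (λ _ → refl)
      indivisible : ∏ (m * p) (λ i → F i unless (p ∣? i)) ≈ ∏∣ m (λ d → f d unless (p ∣? d))
      indivisible = trans (∏-cong (m * p) (λ i _ _ → swap i (p ∣? i)))
        (∏-extend (ℕ.m≤m*n m p) _ λ i m<i → when-false (i ∣? m) (ℕ.>⇒∤ {{ℕ.>-nonZero 1≤m}} m<i))

    -- Once the divisors of m p are regrouped and p is moved inside on the right, both sides of the
    -- hypothesis are products over the divisors of m, and their factors can be compared.
    prime-step : ∀ {x : ℕ → Carrier} → (∀ n → 1 ≤ n → Cancellable (x n)) →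
      (∀ m → 1 ≤ m → ∏∣ (m * p) x ≈ p · ∏∣ m x) →
      ∀ m → 1 ≤ m → x (m * p) ∙ x m unless (p ∣? m) ≈ p · x m
    prime-step {x} cx eq = ∏∣-injective (λ d 1≤d → Cancellable-· p (cx d 1≤d)) λ m 1≤m →
      trans (sym (∏∣-*p m 1≤m x)) (trans (eq m 1≤m)
        (trans (sym (∏-· p m _)) (∏-cong m λ d _ _ → sym (when-· p (x d) (d ∣? m)))))

open RangeProduct ℕ.+-0-commutativeMonoid using ()
  renaming (∏ to ∑)

module Totient where
  open import Data.Nat using (_+_; _*_)
  open RangeProduct ℕ.+-0-commutativeMonoid
    using ( _when_; _unless_; when-cong; when-true; when-false; when-unless; unless-true; unless-false
          ; ∏-cong; ∏-∙; ∏-multiples; ∏-periodic; ∏-ε; p∤⇒coprime)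
  open MonoidMult ℕ.+-0-commutativeMonoid using () renaming (_×_ to _·_)
  open ≡.≡-Reasoning

  ·≡* : ∀ m n → m · n ≡ m * n
  ·≡* zero    n = ≡.refl
  ·≡* (suc m) n = ≡.cong (n ℕ.+_) (·≡* m n)

  length-filter : ∀ {P : ℕ → Set} (P? : Decidable P) k →
    length (filter P? (map suc (upTo k))) ≡ ∑ k (λ i → 1 when P? i)
  length-filter P? zero    = ≡.refl
  length-filter P? (suc k) = begin
    length (filter P? (map suc (upTo (suc k))))
      -- `∑` recurses from its top index, so the list is split at its last element.
      ≡⟨ ≡.cong (λ l → length (filter P? (map suc l))) (List.upTo-∷ʳ k) ⟨
    length (filter P? (map suc (upTo k ++ k ∷ [])))
      ≡⟨ ≡.cong (length ∘ filter P?) (List.map-++ suc (upTo k) (k ∷ [])) ⟩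
    length (filter P? (map suc (upTo k) ++ suc k ∷ []))
      ≡⟨ ≡.cong length (List.filter-++ P? (map suc (upTo k)) (suc k ∷ [])) ⟩
    length (filter P? (map suc (upTo k)) ++ filter P? (suc k ∷ []))
      ≡⟨ List.length-++ (filter P? (map suc (upTo k))) ⟩
    length (filter P? (map suc (upTo k))) + length (filter P? (suc k ∷ []))
      ≡⟨ ≡.cong₂ _+_ (length-filter P? k) last ⟩
    ∑ k (λ i → 1 when P? i) + 1 when P? (suc k)
      ≡⟨ ℕ.+-comm _ (1 when P? (suc k)) ⟩
    ∑ (suc k) (λ i → 1 when P? i)  ∎
    where
    last : length (filter P? (suc k ∷ [])) ≡ 1 when P? (suc k)
    last with does (P? (suc k))
    ... | true  = ≡.refl
    ... | false = ≡.refl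

  φ≡∑ : ∀ n → φ n ≡ ∑ n (λ k → 1 when coprime? n k)
  φ≡∑ n = length-filter (coprime? n) n

  module _ {p : ℕ} (p-prime : Prime p) where
    private
      1≤p : 1 ≤ p
      1≤p = ℕ.>-nonZero⁻¹ p {{prime⇒nonZero p-prime}}

    -- Both sides count the k ≤ m p that are coprime to m. By periodicity there are p φ(m). Those
    -- prime to p are the k coprime to m p; the multiples j p of p contribute φ(m) if p does not
    -- divide m, and nothing otherwise.
    φ-*p : ∀ m → φ (m * p) + φ m unless (p ∣? m) ≡ p * φ m
    φ-*p m = begin
      φ (m * p) + φ m unless (p ∣? m)
        ≡⟨ ≡.cong₂ _+_ prime-to-p multiples-of-p ⟩
      ∑ (m * p) (λ k → χ k unless (p ∣? k)) + ∑ (m * p) (λ k → χ k when (p ∣? k))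
        ≡⟨ ℕ.+-comm _ (∑ (m * p) (λ k → χ k when (p ∣? k))) ⟩
      ∑ (m * p) (λ k → χ k when (p ∣? k)) + ∑ (m * p) (λ k → χ k unless (p ∣? k))
        ≡⟨ ∏-∙ (m * p) _ _ ⟨
      ∑ (m * p) (λ k → χ k when (p ∣? k) + χ k unless (p ∣? k))
        ≡⟨ ∏-cong (m * p) (λ k _ _ → when-unless (χ k) (p ∣? k)) ⟨
      ∑ (m * p) χ
        ≡⟨ ≡.cong (λ j → ∑ j χ) (ℕ.*-comm m p) ⟩
      ∑ (p * m) χ
        ≡⟨ ∏-periodic p m χ (λ k → when-cong (coprime? m (k + m)) (coprime? m k) unshift shift (λ _ → ≡.refl)) ⟩
      p · ∑ m χ
        ≡⟨ ·≡* p (∑ m χ) ⟩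
      p * ∑ m χ
        ≡⟨ ≡.cong (p *_) (φ≡∑ m) ⟨
      p * φ m  ∎
      where
      χ : ℕ → ℕ
      χ k = 1 when coprime? m k

      shift : ∀ {k} → Coprime m k → Coprime m (k + m)
      shift {k} cop {d} (d∣m , d∣k+m) =
        cop (d∣m , ℕ.∣m+n∣m⇒∣n (≡.subst (d ∣_) (ℕ.+-comm k m) d∣k+m) d∣m)
      unshift : ∀ {k} → Coprime m (k + m) → Coprime m k
      unshift cop {d} (d∣m , d∣k) = cop {d} (d∣m , ℕ.∣m∣n⇒∣m+n d∣k d∣m)

      coprime-*p : ∀ {k} → p ∤ k → Coprime m k → Coprime (m * p) k
      coprime-*p p∤k cop {d} (d∣mp , d∣k) =
        cop (Coprimality.coprime-divisor d-p (≡.subst (d ∣_) (ℕ.*-comm m p) d∣mp) , d∣k)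
        where
        d-p : Coprime d p
        d-p = p∤⇒coprime p-prime (λ p∣d → p∤k (ℕ.∣-trans p∣d d∣k))

      prime-to-p : φ (m * p) ≡ ∑ (m * p) (λ k → χ k unless (p ∣? k))
      prime-to-p = ≡.trans (φ≡∑ (m * p)) (∏-cong (m * p) λ k _ _ → same k (p ∣? k))
        where
        same : ∀ k (b : Dec (p ∣ k)) → 1 when coprime? (m * p) k ≡ χ k unless b
        same k (yes p∣k) = when-false (coprime? (m * p) k)
          (λ cop → ℕ.nonTrivial⇒≢1 {{prime⇒nonTrivial p-prime}} (cop (divides m ≡.refl , p∣k)))
        same k (no p∤k)  = when-cong (coprime? (m * p) k) (coprime? m k)
          (λ cop (d∣m , d∣k) → cop (ℕ.∣m⇒∣m*n p d∣m , d∣k)) (coprime-*p p∤k) (λ _ → ≡.refl)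

      multiples-of-p : φ m unless (p ∣? m) ≡ ∑ (m * p) (λ k → χ k when (p ∣? k))
      multiples-of-p = ≡.sym (≡.trans (∏-multiples 1≤p m _ (λ k → when-false (p ∣? k)))
        (≡.trans (∏-cong m λ k _ _ → when-true (p ∣? k * p) (divides k ≡.refl))
        (≡.sym (reduce (p ∣? m)))))
        where
        reduce : (b : Dec (p ∣ m)) → φ m unless b ≡ ∑ m (λ k → χ (k * p))
        reduce (yes p∣m) = ≡.sym (∏-ε m λ k _ _ → when-false (coprime? m (k * p))
          λ cop → ℕ.nonTrivial⇒≢1 {{prime⇒nonTrivial p-prime}} (cop (p∣m , divides k ≡.refl)))
        reduce (no p∤m)  = ≡.trans (φ≡∑ m) (∏-cong m λ k _ _ →
          when-cong (coprime? m k) (coprime? m (k * p)) (times k)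
            (λ cop (d∣m , d∣k) → cop (d∣m , ℕ.∣m⇒∣m*n p d∣k)) (λ _ → ≡.refl))
          where
          times : ∀ k → Coprime m k → Coprime m (k * p)
          times k cop {d} (d∣m , d∣kp) = cop (d∣m , Coprimality.coprime-divisor
            (p∤⇒coprime p-prime (λ p∣d → p∤m (ℕ.∣-trans p∣d d∣m))) (≡.subst (d ∣_) (ℕ.*-comm k p) d∣kp))

    φ-*p-∣ : ∀ m → p ∣ m → φ (m * p) ≡ p * φ m
    φ-*p-∣ m p∣m = ≡.trans (≡.sym (ℕ.+-identityʳ _))
      (≡.trans (≡.cong (φ (m * p) ℕ.+_) (≡.sym (unless-true (p ∣? m) p∣m))) (φ-*p m))

    -- The recursion at m = 1. Without subtraction it splits p copies of an element into φ(p) copies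
    -- and one more, which can be cancelled.
    φ-prime : φ p + 1 ≡ p
    φ-prime = begin
      φ p + 1                              ≡⟨ ≡.cong (λ k → φ k + 1) (ℕ.*-identityˡ p) ⟨
      φ (1 * p) + 1                        ≡⟨ ≡.cong (φ (1 * p) ℕ.+_) (unless-false (p ∣? 1)
                                                λ p∣1 → ℕ.nonTrivial⇒≢1 {{prime⇒nonTrivial p-prime}} (ℕ.∣1⇒≡1 p∣1)) ⟨
      φ (1 * p) + φ 1 unless (p ∣? 1)      ≡⟨ φ-*p 1 ⟩
      p * φ 1                              ≡⟨ ℕ.*-identityʳ p ⟩
      p                                    ∎

-- From the recursion for m p to arguments p^a m

module PrimePowers (M : CommutativeMonoid c ℓ) {p : ℕ} (p-prime : Prime p) where
  open import Data.Nat using (_+_; _*_)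
  open CommutativeMonoid M
  open RangeProduct M
  open MonoidMult M using (×-homo-+; ×-congʳ; ×-assocˡ) renaming (_×_ to _·_)
  open Totient
  open SetoidReasoning setoid

  -- Only the step from a = 0 to a = 1 meets an argument prime to p, and there one copy of x m is
  -- cancelled. Afterwards p divides q m, the extra term is absent, and each step multiplies the
  -- exponent by p, as it does φ(p^a).
  prime-power : ∀ {x : ℕ → Carrier} → (∀ n → 1 ≤ n → Cancellable (x n)) →
    (∀ m → 1 ≤ m → x (m * p) ∙ x m unless (p ∣? m) ≈ p · x m) →
    ∀ a m → 1 ≤ m → p ∤ m → x (p ℕ.^ a * m) ≈ φ (p ℕ.^ a) · x m
  prime-power {x} cx step zero m 1≤m p∤m = begin
    x (m + 0)     ≡⟨ ≡.cong x (ℕ.+-identityʳ m) ⟩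
    x m           ≈⟨ identityʳ (x m) ⟨
    φ 1 · x m     ∎
  prime-power {x} cx step (suc zero) m 1≤m p∤m = begin
    x (p * 1 * m)    ≡⟨ ≡.cong (λ k → x (k * m)) (ℕ.*-identityʳ p) ⟩
    x (p * m)        ≡⟨ ≡.cong x (ℕ.*-comm p m) ⟩
    x (m * p)        ≈⟨ cx m 1≤m (x (m * p)) (φ p · x m) (begin
      x (m * p) ∙ x m                    ≈⟨ ∙-congˡ (unless-false (p ∣? m) p∤m) ⟨
      x (m * p) ∙ x m unless (p ∣? m)    ≈⟨ step m 1≤m ⟩
      p · x m                            ≡⟨ ≡.cong (_· x m) (φ-prime p-prime) ⟨
      (φ p + 1) · x m                    ≈⟨ ×-homo-+ (x m) (φ p) 1 ⟩
      φ p · x m ∙ 1 · x m                ≈⟨ ∙-congˡ (identityʳ (x m)) ⟩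
      φ p · x m ∙ x m                    ∎) ⟩
    φ p · x m        ≡⟨ ≡.cong (λ k → φ k · x m) (ℕ.*-identityʳ p) ⟨
    φ (p * 1) · x m  ∎
  prime-power {x} cx step (suc a@(suc b)) m 1≤m p∤m = begin
    x (p * q * m)         ≡⟨ ≡.cong x (≡.trans (ℕ.*-assoc p q m) (ℕ.*-comm p (q * m))) ⟩
    x (q * m * p)         ≈⟨ identityʳ _ ⟨
    x (q * m * p) ∙ ε     ≈⟨ ∙-congˡ (unless-true (p ∣? q * m) (ℕ.∣m⇒∣m*n m p∣q)) ⟨
    x (q * m * p) ∙ x (q * m) unless (p ∣? q * m)
      ≈⟨ step (q * m) (ℕ.*-mono-≤ 1≤q 1≤m) ⟩
    p · x (q * m)         ≈⟨ ×-congʳ p (prime-power cx step a m 1≤m p∤m) ⟩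
    p · φ q · x m         ≈⟨ ×-assocˡ (x m) p (φ q) ⟩
    (p * φ q) · x m       ≡⟨ ≡.cong (_· x m) (φ-*p-∣ p-prime q p∣q) ⟨
    φ (q * p) · x m       ≡⟨ ≡.cong (λ k → φ k · x m) (ℕ.*-comm q p) ⟩
    φ (p * q) · x m       ∎
    where
    q = p ℕ.^ a
    p∣q : p ∣ q
    p∣q = ℕ.m∣m*n (p ℕ.^ b)
    1≤q : 1 ≤ q
    1≤q = ℕ.m^n>0 p {{prime⇒nonZero p-prime}} a

-- `prime-power` in the additive monoid ℕ, with φ itself as the sequence.
φ-multiplicative : ∀ {p} → Prime p → ∀ a m → 1 ≤ m → p ∤ m →
                   φ (p ℕ.^ a ℕ.* m) ≡ φ (p ℕ.^ a) ℕ.* φ m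
φ-multiplicative {p} p-prime a m 1≤m p∤m = ≡.trans
  (PrimePowers.prime-power ℕ.+-0-commutativeMonoid p-prime
    (λ n _ j k → ℕ.+-cancelʳ-≡ (φ n) j k)
    (λ n _ → ≡.trans (Totient.φ-*p p-prime n) (≡.sym (Totient.·≡* p (φ n)))) a m 1≤m p∤m)
  (Totient.·≡* (φ (p ℕ.^ a)) (φ m))

-- Factorization of X^n - 1 over ℤ

module CyclotomicFactorization (A : CommutativeRing c ℓ) where
  open CommutativeRing A
  open CommutativeExp commutativeSemiring using (_^_; ^-congʳ; ^-assocʳ)
  open Mult semiring using () renaming (_×_ to _·_)
  open SemigroupDivisibility *-commutativeSemigroup
    using (_∣ʳ_; _,_; ∙-cong-∣; x∣ʳy⇒x∣ʳzy; x∣xy; ∣ʳ-respʳ-≈; ∣ʳ-trans)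
  open MonoidDivisibility *-monoid using (ε∣ʳ_; ∣ʳ-refl; ∣ʳ-reflexive)
  open RangeProduct *-commutativeMonoid
  open LinearCombinations A
  open SetoidReasoning setoid

  -- `Φ` and `Monic` are parameters, so the recursive division behind Φ is never unfolded. It enters
  -- only through `Φ-quotient`, which turns divisibility by the product over the proper divisors
  -- into a factorization.
  module MonicDivision
    (X : Carrier) (Φ : ℕ → Carrier)
    (Monic          : Carrier → Set o)
    (Monic-1        : Monic 1#)
    (Monic-*        : ∀ {f g} → Monic f → Monic g → Monic (f * g))
    (Monic-Xⁿ-1     : ∀ {n} → 1 ≤ n → Monic (X ^ n - 1#))
    (Monic-factor   : ∀ {f g h} → Monic g → Monic h → h ≈ f * g → Monic f)
    (Monic-cancel   : ∀ {g} → Monic g → Cancellable g)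
    (exact-division : ∀ f {g} s → Monic g → 1 ≤ s → g ∣ʳ s · 1# * f → g ∣ʳ f)
    (Φ-quotient     : ∀ n → Monic (∏∣≤ (suc n) n Φ) → ∏∣≤ (suc n) n Φ ∣ʳ X ^ suc n - 1# →
                      X ^ suc n - 1# ≈ Φ (suc n) * ∏∣≤ (suc n) n Φ)
    where

    ∏Φ : ℕ → ℕ → Carrier
    ∏Φ n k = ∏∣≤ n k Φ

    ∏Φ-monoˡ : ∀ {m n} → m ∣ n → ∀ k → ∏Φ m k ∣ʳ ∏Φ n k
    ∏Φ-monoˡ         m∣n zero    = ∣ʳ-refl
    ∏Φ-monoˡ {m} {n} m∣n (suc k) = ∙-cong-∣ (factor (suc k ∣? m)) (∏Φ-monoˡ m∣n k)
      where
      factor : (b : Dec (suc k ∣ m)) → Φ (suc k) when b ∣ʳ Φ (suc k) when (suc k ∣? n)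
      factor (yes d∣m) = ∣ʳ-reflexive (sym (when-true (suc k ∣? n) (ℕ.∣-trans d∣m m∣n)))
      factor (no _)    = ε∣ʳ _

    ∏Φ-monoʳ : ∀ n {k l} → k ≤ l → ∏Φ n k ∣ʳ ∏Φ n l
    ∏Φ-monoʳ n {k} {l} k≤l with ℕ.m≤n⇒∃[o]m+o≡n k≤l
    ... | o , ≡.refl = ≡.subst (λ j → ∏Φ n k ∣ʳ ∏Φ n j) (ℕ.+-comm o k) (go o)
      where
      go : ∀ o → ∏Φ n k ∣ʳ ∏Φ n (o ℕ.+ k)
      go zero    = ∣ʳ-refl
      go (suc o) = x∣ʳy⇒x∣ʳzy _ (go o)

    Factorized : ℕ → Set _
    Factorized d = Monic (Φ d) × X ^ d - 1# ≈ Φ d * ∏Φ d (ℕ.pred d)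

    FactorizedBelow : ℕ → Set _
    FactorizedBelow n = ∀ d → 1 ≤ d → d < n → Factorized d

    factorized⇒∏ : ∀ {d} → 1 ≤ d → Factorized d → ∏Φ d d ≈ X ^ d - 1#
    factorized⇒∏ {suc d} _ (_ , eq) =
      trans (*-congʳ (when-true (suc d ∣? suc d) ℕ.∣-refl)) (sym eq)

    factorized⇒Φ∣ : ∀ {d} → Factorized d → Φ d ∣ʳ X ^ d - 1#
    factorized⇒Φ∣ (_ , eq) = ∣ʳ-respʳ-≈ (sym eq) (x∣xy _ _)

    Xᵐ-1∣Xⁿ-1 : ∀ {m n} → m ∣ n → X ^ m - 1# ∣ʳ X ^ n - 1#
    Xᵐ-1∣Xⁿ-1 {m} (divides q ≡.refl) = proj₁ (xᵐⁿ-1 X m q) , sym (proj₂ (xᵐⁿ-1 X m q))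

    -- With g = gcd d e and X^d - 1 = S (X^g - 1), the polynomial S is a multiple of Φ d
    -- and is congruent to d / g modulo X^g - 1, which lies in the ideal (X^d - 1, X^e - 1).
    Φ-comaximal : ∀ {e d} → 1 ≤ e → e < d → Factorized e → Factorized d → FactorizedBelow d →
                  ∃ λ s → 1 ≤ s × s · 1# ∈⟨ Φ d , Φ e ⟩
    Φ-comaximal {e} {d} 1≤e e<d fact-e (_ , eq-d) below with gcd[m,n]∣m d e
    ... | divides s d≡sg = s , 1≤s , ∈⟨Φd,Φe⟩
      where
      g = gcd d e
      1≤g : 1 ≤ g
      1≤g = ℕ.n≢0⇒n>0 (gcd[m,n]≢0 d e (inj₂ (ℕ.n>0⇒n≢0 1≤e)))
      g≤e : g ≤ e
      g≤e = ℕ.∣⇒≤ {{ℕ.>-nonZero 1≤e}} (gcd[m,n]∣n d e)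
      g<d : g < d
      g<d = ℕ.≤-<-trans g≤e e<d
      1≤s : 1 ≤ s
      1≤s = ℕ.n≢0⇒n>0 λ { ≡.refl → contradiction (≡.subst (e <_) d≡sg e<d) ℕ.n≮0 }
      S Y-1 : Carrier
      S   = geometric (X ^ g) s
      Y-1 = X ^ g - 1#
      Xᵈ-1 : X ^ d - 1# ≈ S * Y-1
      Xᵈ-1 = trans (+-congʳ (trans (^-congʳ X (≡.trans d≡sg (ℕ.*-comm s g))) (sym (^-assocʳ X g s))))
                   (xⁿ-1 (X ^ g) s)
      -- Since g ≤ e < d, the divisors of g are proper divisors of d, and the product of their Φ is
      -- X^g - 1. Cancelling it from X^d - 1 = Φ d * rest leaves S as a multiple of Φ d.
      Y-1∣rest : Y-1 ∣ʳ ∏Φ d (ℕ.pred d)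
      Y-1∣rest = ∣ʳ-trans (∣ʳ-reflexive (sym (factorized⇒∏ 1≤g (below g 1≤g g<d))))
                (∣ʳ-trans (∏Φ-monoˡ (gcd[m,n]∣m d e) g)
                          (∏Φ-monoʳ d (ℕ.<⇒≤pred g<d)))
      S-factor : ∃ λ r → S ≈ r * Φ d
      S-factor =
        let r , rY≈rest = Y-1∣rest in r , Monic-cancel (Monic-Xⁿ-1 1≤g) S (r * Φ d) (begin
          S * Y-1                      ≈⟨ Xᵈ-1 ⟨
          X ^ d - 1#                   ≈⟨ eq-d ⟩
          Φ d * ∏Φ d (ℕ.pred d)        ≈⟨ *-congˡ rY≈rest ⟨
          Φ d * (r * Y-1)              ≈⟨ *-assoc (Φ d) r Y-1 ⟨
          Φ d * r * Y-1                ≈⟨ *-congʳ (*-comm (Φ d) r) ⟩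
          r * Φ d * Y-1                ∎)
      ∈⟨Φd,Φe⟩ : s · 1# ∈⟨ Φ d , Φ e ⟩
      ∈⟨Φd,Φe⟩ =
        let r , S≈rΦ = S-factor
            t , tΦ≈  = factorized⇒Φ∣ fact-e
        in ∈-mono (∈-trans (n∈⟨geometric,x-1⟩ (X ^ g) s)
                    (∈-mono (xᵍ-1∈⟨xᵐ-1,xⁿ-1⟩ X d e)
                      (trans Xᵈ-1 (trans (*-comm S Y-1) (sym (*-identityˡ _)))) (sym tΦ≈)))
             S≈rΦ (sym (*-identityˡ (Φ e)))

    module _ {n : ℕ} (below : FactorizedBelow n) where

      -- The pairwise relations are multiplied together by `∈-product`, and so are their integers.
      ∏Φ-comaximal : ∀ {d} → d < n → 1 ≤ d → ∀ k → k < d →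
        ∃ λ s → 1 ≤ s × s · 1# ∈⟨ Φ d , ∏Φ n k ⟩
      ∏Φ-comaximal {d} d<n 1≤d zero    _   = 1 , ℕ.≤-refl , 0# , 1# ,
        trans (+-identityʳ 1#) (sym (trans (+-cong (zeroˡ (Φ d)) (*-identityˡ 1#)) (+-identityˡ 1#)))
      ∏Φ-comaximal {d} d<n 1≤d (suc k) k<d = extend (suc k ∣? n)
        where
        extend : (b : Dec (suc k ∣ n)) → ∃ λ s → 1 ≤ s × s · 1# ∈⟨ Φ d , Φ (suc k) when b * ∏Φ n k ⟩
        rest = ∏Φ-comaximal d<n 1≤d k (ℕ.<-trans (ℕ.n<1+n k) k<d)
        extend (no _)  =
          let s , 1≤s , u , v , eq = rest in
          s , 1≤s , u , v , trans eq (+-congˡ (*-congˡ (sym (*-identityˡ (∏Φ n k)))))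
        extend (yes _) =
          let s , 1≤s , ∈ = rest
              s′ , 1≤s′ , ∈′ = Φ-comaximal (s≤s z≤n) k<d (below (suc k) (s≤s z≤n) (ℕ.<-trans k<d d<n))
                                 (below d 1≤d d<n) (λ c 1≤c c<d → below c 1≤c (ℕ.<-trans c<d d<n))
              u , v , eq = ∈-product ∈′ ∈
          in s′ ℕ.* s , ℕ.*-mono-≤ 1≤s′ 1≤s , u , v , trans (Mult.×1-homo-* semiring s′ s) eq

      ∏Φ-monic : ∀ k → k < n → Monic (∏Φ n k)
      ∏Φ-monic zero    _   = Monic-1
      ∏Φ-monic (suc k) k<n = Monic-* (factor (suc k ∣? n)) (∏Φ-monic k (ℕ.<-trans (ℕ.n<1+n k) k<n))
        where
        factor : (b : Dec (suc k ∣ n)) → Monic (Φ (suc k) when b)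
        factor (no _)  = Monic-1
        factor (yes _) = proj₁ (below (suc k) (s≤s z≤n) k<n)

      -- The new factor and the product so far both divide X^n - 1 and are comaximal up to an
      -- integer s. The integer is removed at every step, so the induction hypothesis remains free
      -- of it.
      ∏Φ∣Xⁿ-1 : ∀ k → k < n → ∏Φ n k ∣ʳ X ^ n - 1#
      ∏Φ∣Xⁿ-1 zero    _   = ε∣ʳ _
      ∏Φ∣Xⁿ-1 (suc k) k<n =
        let s , 1≤s , ∏∣multiple = multiple (suc k ∣? n)
        in exact-division _ s (∏Φ-monic (suc k) k<n) 1≤s ∏∣multiple
        where
        rest = ∏Φ∣Xⁿ-1 k (ℕ.<-trans (ℕ.n<1+n k) k<n)
        multiple : (b : Dec (suc k ∣ n)) →
                   ∃ λ s → 1 ≤ s × Φ (suc k) when b * ∏Φ n k ∣ʳ s · 1# * (X ^ n - 1#)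
        multiple (no _)    =
          let h , eq = rest
          in 1 , ℕ.≤-refl , h ,
             trans (*-congˡ (*-identityˡ _)) (trans eq (sym (trans (*-congʳ (+-identityʳ 1#)) (*-identityˡ _))))
        multiple (yes d∣n) =
          let h , eq = rest
              t , tΦ≈ = ∣ʳ-trans (factorized⇒Φ∣ (below (suc k) (s≤s z≤n) k<n)) (Xᵐ-1∣Xⁿ-1 d∣n)
              s , 1≤s , ∈ = ∏Φ-comaximal k<n (s≤s z≤n) k ℕ.≤-refl
              h′ , eq′ = common-multiple ∈ (sym tΦ≈) (sym eq)
          in s , 1≤s , h′ , sym eq′

    factorized : ∀ n → 1 ≤ n → Factorized n
    factorized = <-rec (λ n → 1 ≤ n → Factorized n) step
      where
      step : ∀ n → (∀ {d} → d < n → 1 ≤ d → Factorized d) → 1 ≤ n → Factorized n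
      step (suc n) rec 1≤n = Monic-factor monic (Monic-Xⁿ-1 1≤n) eq , eq
        where
        below : FactorizedBelow (suc n)
        below d 1≤d d<n = rec d<n 1≤d
        monic = ∏Φ-monic below n ℕ.≤-refl
        eq = Φ-quotient n monic (∏Φ∣Xⁿ-1 below n ℕ.≤-refl)

module _ where
  open CommutativeRing ℤ[X]
  open CommutativeExp commutativeSemiring using (_^_)
  open Mult semiring using () renaming (_×_ to _·_)
  open Polynomial ℤ.+-*-commutativeRing using (Poly; X; coeffwise; const; divModMonic)
  open PolynomialDivision ℤ.+-*-commutativeRing
  open SemigroupDivisibility *-commutativeSemigroup using (_∣ʳ_; _,_)
  open RangeProduct *-commutativeMonoid

  -- Hides the degree, because `MonicDivision` expects a predicate of the polynomial alone.
  record IsMonic (f : Poly) : Set where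
    constructor ofDegree
    field
      deg   : ℕ
      monic : Monic f deg

  ∏Φ : ℕ → ℕ → Poly
  ∏Φ n k = ∏∣≤ n k Φ

  ∏Φ-divisors≡∏Φ : ∀ n k → ∏Φ-divisors n k ≡ ∏Φ n k
  ∏Φ-divisors≡∏Φ n zero    = ≡.refl
  ∏Φ-divisors≡∏Φ n (suc k) = ≡.cong (Φ (suc k) when (suc k ∣? n) *_) (∏Φ-divisors≡∏Φ n k)

  private
    ·1≈const : ∀ s → s · 1# ≈ const (+ s)
    ·1≈const zero    = coeffwise λ { zero → ≡.refl ; (suc i) → ≡.refl }
    ·1≈const (suc s) = +-congˡ {1#} (·1≈const s)

    regular : ∀ {s} → 1 ≤ s → ∀ {x} → + s ℤ.* x ≡ 0ℤ → x ≡ 0ℤ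
    regular {suc s} _ {x} eq with ℤ.i*j≡0⇒i≡0∨j≡0 (+ suc s) eq
    ... | inj₂ x≡0 = x≡0

    division : ∀ {f g s k} → Monic g k → 1 ≤ s → g ∣ʳ s · 1# * f → f ≈ proj₁ (divModMonic g k f) * g
    division {f} {s = s} monic 1≤s (h , eq) = divModMonic-exact monic {a = + s} (regular 1≤s) f h
      (trans (*-congʳ (sym (·1≈const s))) (sym eq))

    quotient : ∀ n g → IsMonic g → g ∣ʳ X ^ suc n - 1# →
      X ^ suc n - 1# ≈ proj₁ (divModMonic g (degree g) (X ^ suc n - 1#)) * g
    quotient n g (ofDegree k monic) (h , eq) rewrite degree-Monic g monic =
      division {s = 1} monic ℕ.≤-refl (h , trans eq (sym (trans (*-congʳ (+-identityʳ 1#)) (*-identityˡ _))))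

    Φ-quotient : ∀ n → IsMonic (∏Φ (suc n) n) → ∏Φ (suc n) n ∣ʳ X ^ suc n - 1# →
                 X ^ suc n - 1# ≈ Φ (suc n) * ∏Φ (suc n) n
    Φ-quotient n monic ∏Φ∣ = trans (quotient n _ monic ∏Φ∣)
      (*-congʳ (reflexive (≡.cong (λ g → proj₁ (divModMonic g (degree g) (X ^ suc n - 1#)))
        (≡.sym (∏Φ-divisors≡∏Φ (suc n) n)))))

    IsMonic-1 : IsMonic 1#
    IsMonic-1 = ofDegree 0 Monic-1

    IsMonic-* : ∀ {f g} → IsMonic f → IsMonic g → IsMonic (f * g)
    IsMonic-* {f} {g} (ofDegree k monic-f) (ofDegree m monic-g) =
      ofDegree (k ℕ.+ m) (Monic-⊛ {f} {g} monic-f monic-g)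

    IsMonic-Xⁿ-1 : ∀ {n} → 1 ≤ n → IsMonic (X ^ n - 1#)
    IsMonic-Xⁿ-1 {suc n} _ = ofDegree (suc n) (Monic-Xⁿ-1 n)

    IsMonic-factor : ∀ {f g h} → IsMonic g → IsMonic h → h ≈ f * g → IsMonic f
    IsMonic-factor {f} {g} {h} (ofDegree _ monic-g) (ofDegree _ monic-h) h≈fg =
      let k , monic-f = Monic-factor {f} {g} {h} monic-g monic-h h≈fg in ofDegree k monic-f

    IsMonic-cancel : ∀ {g} → IsMonic g → Cancellable g
    IsMonic-cancel (ofDegree _ monic-g) = Monic-cancelʳ monic-g

    exact-division : ∀ f {g} s → IsMonic g → 1 ≤ s → g ∣ʳ s · 1# * f → g ∣ʳ f
    exact-division f {g} s (ofDegree k monic-g) 1≤s g∣sf =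
      proj₁ (divModMonic g k f) , sym (division {f} {g} {s} monic-g 1≤s g∣sf)

  open CyclotomicFactorization ℤ[X]
  open MonicDivision X Φ IsMonic IsMonic-1 IsMonic-* IsMonic-Xⁿ-1 IsMonic-factor IsMonic-cancel
    exact-division Φ-quotient using (factorized; factorized⇒∏)

  ∏Φ≈Xⁿ-1 : ∀ n → 1 ≤ n → ∏∣ n Φ ≈ X ^ n - 1#
  ∏Φ≈Xⁿ-1 n 1≤n = factorized⇒∏ 1≤n (factorized n 1≤n)

  Φ-monic : ∀ n → 1 ≤ n → IsMonic (Φ n)
  Φ-monic n 1≤n = proj₁ (factorized n 1≤n)

-- Homomorphisms and Frobenius

module HomomorphismProperties
  (R : CommutativeRing c ℓ) (S : CommutativeRing f ℓ′)
  {h : CommutativeRing.Carrier R → CommutativeRing.Carrier S}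
  (homo : IsHomomorphism R S h) where

  private
    module R = CommutativeRing R
    module PR = Polynomial R
    module PS = Polynomial S
    module DR = PolynomialDivision R
    module DS = PolynomialDivision S
  open CommutativeRing S
  open CommutativeExp R.commutativeSemiring using () renaming (_^_ to _^ᴿ_)
  open CommutativeExp commutativeSemiring using (_^_)
  open Mult R.semiring using () renaming (_×_ to _·ᴿ_)
  open Mult semiring using () renaming (_×_ to _·_)
  open IsHomomorphism R S homo
  open RangeProduct R.*-commutativeMonoid using () renaming (∏∣ to ∏∣ᴿ; ∏ to ∏ᴿ; _when_ to _whenᴿ_)
  open RangeProduct *-commutativeMonoid using (∏∣; ∏; _when_)

  ^-homo : ∀ x n → h (x ^ᴿ n) ≈ h x ^ n
  ^-homo x zero    = 1#-homo
  ^-homo x (suc n) = trans (*-homo x _) (*-congˡ (^-homo x n))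

  ·-homo : ∀ n x → h (n ·ᴿ x) ≈ n · h x
  ·-homo zero    x = 0#-homo
  ·-homo (suc n) x = trans (+-homo x _) (+-congˡ (·-homo n x))

  minus-homo : ∀ x y → h (x R.- y) ≈ h x - h y
  minus-homo x y = trans (+-homo x _) (+-congˡ (-‿homo y))

  ∏∣-homo : ∀ n f → h (∏∣ᴿ n f) ≈ ∏∣ n (λ i → h (f i))
  ∏∣-homo n f = go n
    where
    factor : ∀ {P : Set} x (b : Dec P) → h (x whenᴿ b) ≈ h x when b
    factor x (yes _) = refl
    factor x (no _)  = 1#-homo
    go : ∀ k → h (∏ᴿ k (λ i → f i whenᴿ (i ℕ.∣? n))) ≈ ∏ k (λ i → h (f i) when (i ℕ.∣? n))
    go zero    = 1#-homo
    go (suc k) = trans (*-homo _ _) (*-cong (factor (f (suc k)) (suc k ℕ.∣? n)) (go k))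

  coeff-map : ∀ f i → PS.coeff (map h f) i ≈ h (PR.coeff f i)
  coeff-map []      i       = sym 0#-homo
  coeff-map (a ∷ f) zero    = refl
  coeff-map (a ∷ f) (suc i) = coeff-map f i

  map-cong : ∀ {f g} → f PR.≋ g → map h f PS.≋ map h g
  map-cong {f} {g} f≋g .PS.coeff-≈ i =
    trans (coeff-map f i) (trans (⟦⟧-cong (PR.coeff-≈ f≋g i)) (sym (coeff-map g i)))

  map-⊕ : ∀ f g → map h (f PR.⊕ g) PS.≋ map h f PS.⊕ map h g
  map-⊕ f g .PS.coeff-≈ i = begin
    PS.coeff (map h (f PR.⊕ g)) i                     ≈⟨ coeff-map (f PR.⊕ g) i ⟩
    h (PR.coeff (f PR.⊕ g) i)                         ≈⟨ ⟦⟧-cong (PR.coeff-⊕ f g i) ⟩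
    h (PR.coeff f i R.+ PR.coeff g i)                 ≈⟨ +-homo _ _ ⟩
    h (PR.coeff f i) + h (PR.coeff g i)               ≈⟨ +-cong (coeff-map f i) (coeff-map g i) ⟨
    PS.coeff (map h f) i + PS.coeff (map h g) i       ≈⟨ PS.coeff-⊕ (map h f) (map h g) i ⟨
    PS.coeff (map h f PS.⊕ map h g) i                 ∎
    where open SetoidReasoning setoid

  map-⊖ : ∀ f → map h (PR.⊖ f) PS.≋ PS.⊖ map h f
  map-⊖ []      = PS.≋-refl
  map-⊖ (a ∷ f) = PS.∷-cong (-‿homo a) (map-⊖ f)

  map-⊙ : ∀ a f → map h (a PR.⊙ f) PS.≋ h a PS.⊙ map h f
  map-⊙ a []      = PS.≋-refl
  map-⊙ a (b ∷ f) = PS.∷-cong (*-homo a b) (map-⊙ a f)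

  map-⊛ : ∀ f g → map h (f PR.⊛ g) PS.≋ map h f PS.⊛ map h g
  map-⊛ []      g = PS.≋-refl
  map-⊛ (a ∷ f) g = PS.≋-trans (map-⊕ (a PR.⊙ g) (R.0# ∷ f PR.⊛ g))
    (PS.⊕-cong (map-⊙ a g) (PS.∷-cong 0#-homo (map-⊛ f g)))

  map-homo : IsHomomorphism PR.polynomialRing PS.polynomialRing (map h)
  map-homo = record
    { isSemiringHomomorphism = record
      { isNearSemiringHomomorphism = record
        { +-isMonoidHomomorphism = record
          { isMagmaHomomorphism = record
            { isRelHomomorphism = record { cong = map-cong }
            ; homo = map-⊕
            }
          ; ε-homo = PS.≋-refl
          }
        ; *-homo = map-⊛
        }
      ; 1#-homo = PS.∷-cong 1#-homo PS.≋-refl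
      }
    ; -‿homo = map-⊖
    }

  Monic-map : ∀ {f k} → DR.Monic f k → DS.Monic (map h f) k
  Monic-map {f} {k} (top , above) =
    trans (coeff-map f k) (trans (⟦⟧-cong top) 1#-homo) ,
    λ i k<i → trans (coeff-map f i) (trans (⟦⟧-cong (above i k<i)) 0#-homo)

-- Evaluation and constant polynomials as homomorphisms

module PolynomialEvaluation (R : CommutativeRing c ℓ) where
  open CommutativeRing R
  open Polynomial R
  open IntegerCoefficients R using (solve; _:=_; _:+_; _:*_)
  open RingProperties ring using (-0#≈0#; -‿distribʳ-*)
  open AbelianGroupProperties +-abelianGroup using (⁻¹-∙-comm)

  module _ (x : Carrier) where

    eval-zero : ∀ {f} → f ≋ [] → eval f x ≈ 0#
    eval-zero {[]}    _   = refl
    eval-zero {a ∷ f} f≋0 = trans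
      (+-cong (coeff-≈ f≋0 0) (trans (*-congˡ (eval-zero (tail-≋[] f≋0))) (zeroʳ x))) (+-identityʳ 0#)

    eval-cong : ∀ {f g} → f ≋ g → eval f x ≈ eval g x
    eval-cong {[]}    {g}     f≋g = sym (eval-zero (≋-sym f≋g))
    eval-cong {a ∷ f} {[]}    f≋g = eval-zero f≋g
    eval-cong {a ∷ f} {b ∷ g} f≋g = +-cong (coeff-≈ f≋g 0) (*-congˡ (eval-cong (tail-≋ f≋g)))

    eval-⊕ : ∀ f g → eval (f ⊕ g) x ≈ eval f x + eval g x
    eval-⊕ []      g       = sym (+-identityˡ _)
    eval-⊕ (a ∷ f) []      = sym (+-identityʳ _)
    eval-⊕ (a ∷ f) (b ∷ g) = trans (+-congˡ (*-congˡ (eval-⊕ f g)))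
      (solve 5 (λ a b x u v → (a :+ b) :+ x :* (u :+ v) := (a :+ x :* u) :+ (b :+ x :* v))
         refl a b x (eval f x) (eval g x))

    eval-⊖ : ∀ f → eval (⊖ f) x ≈ - eval f x
    eval-⊖ []      = sym -0#≈0#
    eval-⊖ (a ∷ f) = trans (+-congˡ (trans (*-congˡ (eval-⊖ f)) (sym (-‿distribʳ-* x _)))) (⁻¹-∙-comm a _)

    eval-⊙ : ∀ a f → eval (a ⊙ f) x ≈ a * eval f x
    eval-⊙ a []      = sym (zeroʳ a)
    eval-⊙ a (b ∷ f) = trans (+-congˡ (*-congˡ (eval-⊙ a f)))
      (solve 4 (λ a b x u → a :* b :+ x :* (a :* u) := a :* (b :+ x :* u)) refl a b x (eval f x))

    eval-⊛ : ∀ f g → eval (f ⊛ g) x ≈ eval f x * eval g x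
    eval-⊛ []      g = sym (zeroˡ _)
    eval-⊛ (a ∷ f) g = begin
      eval (a ⊙ g ⊕ (0# ∷ f ⊛ g)) x                ≈⟨ eval-⊕ (a ⊙ g) (0# ∷ f ⊛ g) ⟩
      eval (a ⊙ g) x + (0# + x * eval (f ⊛ g) x)
        ≈⟨ +-cong (eval-⊙ a g) (trans (+-identityˡ _) (*-congˡ (eval-⊛ f g))) ⟩
      a * eval g x + x * (eval f x * eval g x)     ≈⟨ +-congˡ (*-assoc x _ _) ⟨
      a * eval g x + x * eval f x * eval g x       ≈⟨ distribʳ _ a _ ⟨
      (a + x * eval f x) * eval g x                ∎
      where open SetoidReasoning setoid

    eval-homo : IsHomomorphism polynomialRing R (λ f → eval f x)
    eval-homo = record
      { isSemiringHomomorphism = record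
        { isNearSemiringHomomorphism = record
          { +-isMonoidHomomorphism = record
            { isMagmaHomomorphism = record
              { isRelHomomorphism = record { cong = eval-cong }
              ; homo = eval-⊕
              }
            ; ε-homo = refl
            }
          ; *-homo = eval-⊛
          }
        ; 1#-homo = trans (+-congˡ (zeroʳ x)) (+-identityʳ 1#)
        }
      ; -‿homo = eval-⊖
      }

  const-homo : IsHomomorphism R polynomialRing const
  const-homo = record
    { isSemiringHomomorphism = record
      { isNearSemiringHomomorphism = record
        { +-isMonoidHomomorphism = record
          { isMagmaHomomorphism = record
            { isRelHomomorphism = record { cong = λ a≈b → ∷-cong a≈b ≋-refl }
            ; homo = λ _ _ → ≋-refl
            }
          ; ε-homo = 0∷-≋[] refl ≋-refl
          }
        ; *-homo = λ a b → ∷-cong (sym (+-identityʳ (a * b))) ≋-refl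
        }
      ; 1#-homo = ≋-refl
      }
    ; -‿homo = λ _ → ≋-refl
    }

-- Binomial coefficients modulo p and the Frobenius map

prime∤! : ∀ {p} → Prime p → ∀ {k} → k < p → p ∤ k !
prime∤! p-prime {zero}  _   p∣1 = ℕ.nonTrivial⇒≢1 {{prime⇒nonTrivial p-prime}} (ℕ.∣1⇒≡1 p∣1)
prime∤! p-prime {suc k} k<p p∣ with euclidsLemma (suc k) (k !) p-prime p∣
... | inj₁ p∣k+1 = ℕ.>⇒∤ k<p p∣k+1
... | inj₂ p∣k!  = prime∤! p-prime (ℕ.<-trans (ℕ.n<1+n k) k<p) p∣k!

-- p divides p! = C(p,k) k! (p-k)!, but neither of the two factorials, since k and p - k are less
-- than p.
prime∣C : ∀ {p} → Prime p → ∀ {k} → 1 ≤ k → k < p → p ∣ p ℕ.C k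
prime∣C {p} p-prime {k} 1≤k k<p
  with euclidsLemma (p ℕ.C k) (k ! ℕ.* (p ℕ.∸ k) !) p-prime
         (≡.subst (p ∣_) (≡.sym Ck!≡p!) (p∣p! p {{prime⇒nonZero p-prime}}))
  where
  instance _ = k ℕ.!* (p ℕ.∸ k) !≢0
  Ck!≡p! : (p ℕ.C k) ℕ.* (k ! ℕ.* (p ℕ.∸ k) !) ≡ p !
  Ck!≡p! = ≡.trans (≡.cong (ℕ._* (k ! ℕ.* (p ℕ.∸ k) !)) (ℕ.nCk≡n!/k![n-k]! (ℕ.<⇒≤ k<p)))
    (m/n*n≡m (ℕ.k![n∸k]!∣n! (ℕ.<⇒≤ k<p)))
  p∣p! : ∀ p .{{_ : ℕ.NonZero p}} → p ∣ p !
  p∣p! (suc p) = ℕ.m∣m*n (p !)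
... | inj₁ p∣C = p∣C
... | inj₂ p∣k!j! with euclidsLemma (k !) ((p ℕ.∸ k) !) p-prime p∣k!j!
...   | inj₁ p∣k! = contradiction p∣k! (prime∤! p-prime k<p)
...   | inj₂ p∣j! = contradiction p∣j! (prime∤! p-prime (ℕ.∸-monoʳ-< 1≤k (ℕ.<⇒≤ k<p)))

-- Weaker than having characteristic p, as the zero ring is allowed; in this form it passes along
-- every homomorphism.
_annihilates_ : ℕ → CommutativeRing c ℓ → Set ℓ
p annihilates R = p · 1# ≈ 0#
  where
  open CommutativeRing R
  open Mult semiring renaming (_×_ to _·_)

annihilates-homo : ∀ (R : CommutativeRing c ℓ) (S : CommutativeRing f ℓ′) {h} →
  IsHomomorphism R S h → ∀ {p} → p annihilates R → p annihilates S
annihilates-homo R S homo {p} p·1≈0 = begin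
  p · 1#             ≈⟨ ×-congʳ p 1#-homo ⟨
  p · _              ≈⟨ ·-homo p (CommutativeRing.1# R) ⟨
  _                  ≈⟨ ⟦⟧-cong p·1≈0 ⟩
  _                  ≈⟨ 0#-homo ⟩
  0#                 ∎
  where
  open CommutativeRing S
  open Mult semiring renaming (_×_ to _·_)
  open IsHomomorphism R S homo using (⟦⟧-cong; 0#-homo; 1#-homo)
  open HomomorphismProperties R S homo using (·-homo)
  open SetoidReasoning setoid

module Frobenius (R : CommutativeRing c ℓ) {p : ℕ} (p-prime : Prime p) (p·1≈0 : p annihilates R) where

  open CommutativeRing R
  open Mult semiring using () renaming (_×_ to _·_)
  open CommutativeExp commutativeSemiring
  open Mult semiring using (×-assoc-*; ×-congʳ; ×-assocˡ; ×-homo-1)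
  open Sum semiring using (sum; sum-init-last; sum-cong-≋; sum-replicate-zero)
  open GroupProperties +-group using (//-rightDividesˡ; //-rightDividesʳ)
  open SetoidReasoning setoid

  p∣n⇒n·x≈0 : ∀ {n} → p ∣ n → ∀ x → n · x ≈ 0#
  p∣n⇒n·x≈0 (divides m ≡.refl) x = begin
    (m ℕ.* p) · x        ≡⟨ ≡.cong (_· x) (ℕ.*-comm m p) ⟩
    (p ℕ.* m) · x        ≈⟨ ×-assocˡ x p m ⟨
    p · m · x            ≈⟨ ×-congʳ p (*-identityˡ _) ⟨
    p · (1# * m · x)     ≈⟨ ×-assoc-* p 1# _ ⟨
    p · 1# * m · x       ≈⟨ *-congʳ p·1≈0 ⟩
    0# * m · x           ≈⟨ zeroˡ _ ⟩
    0#                   ∎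

  [x+y]ᵖ : ∀ x y → (x + y) ^ p ≈ x ^ p + y ^ p
  [x+y]ᵖ x y = expand p ≡.refl
    where
    -- The copy n exposes p as a successor, so that the first term of the binomial sum can be split
    -- off as well as the last.
    expand : ∀ n → n ≡ p → (x + y) ^ n ≈ x ^ n + y ^ n
    expand zero    ≡.refl = contradiction p-prime ¬prime[0]
    expand (suc n) ≡.refl = begin
      (x + y) ^ p
        ≈⟨ Binomial.theorem commutativeSemiring p x y ⟩
      sum term
        ≈⟨ sum-init-last term ⟩
      sum (λ i → term (Fin.inject₁ i)) + term (Fin.fromℕ p)
        ≈⟨ +-cong (+-congˡ (trans (sum-cong-≋ middle) (sum-replicate-zero n))) last ⟩
      term Fin.zero + 0# + x ^ p
        ≈⟨ +-congʳ (+-identityʳ _) ⟩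
      term Fin.zero + x ^ p
        ≈⟨ +-congʳ (trans (×-homo-1 _) (*-identityˡ _)) ⟩
      y ^ p + x ^ p
        ≈⟨ +-comm _ _ ⟩
      x ^ p + y ^ p   ∎
      where
      term : Fin (suc p) → Carrier
      term k = (p ℕ.C toℕ k) · (x ^ toℕ k * y ^ (p ℕ.∸ toℕ k))
      middle : ∀ i → term (Fin.inject₁ (Fin.suc i)) ≈ 0#
      middle i = p∣n⇒n·x≈0 (prime∣C p-prime (s≤s z≤n)
        (≡.subst (_< p) (≡.sym (≡.cong suc (Fin.toℕ-inject₁ i))) (s≤s (Fin.toℕ<n i)))) _
      last : term (Fin.fromℕ p) ≈ x ^ p
      last = trans (reflexive (≡.cong (λ k → (p ℕ.C k) · (x ^ k * y ^ (p ℕ.∸ k))) (Fin.toℕ-fromℕ p)))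
        (trans (reflexive (≡.cong₂ (λ j k → j · (x ^ p * y ^ k)) (ℕ.nCn≡1 p) (ℕ.n∸n≡0 p)))
        (trans (×-homo-1 _) (*-identityʳ _)))

  [x+y]ᵖᵃ : ∀ a x y → (x + y) ^ (p ℕ.^ a) ≈ x ^ (p ℕ.^ a) + y ^ (p ℕ.^ a)
  [x+y]ᵖᵃ zero    x y = trans (*-identityʳ _) (+-cong (sym (*-identityʳ x)) (sym (*-identityʳ y)))
  [x+y]ᵖᵃ (suc a) x y = begin
    (x + y) ^ (p ℕ.* p ℕ.^ a)                       ≈⟨ ^-assocʳ (x + y) p (p ℕ.^ a) ⟨
    ((x + y) ^ p) ^ (p ℕ.^ a)                       ≈⟨ ^-congˡ (p ℕ.^ a) ([x+y]ᵖ x y) ⟩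
    (x ^ p + y ^ p) ^ (p ℕ.^ a)                     ≈⟨ [x+y]ᵖᵃ a (x ^ p) (y ^ p) ⟩
    (x ^ p) ^ (p ℕ.^ a) + (y ^ p) ^ (p ℕ.^ a)
      ≈⟨ +-cong (^-assocʳ x p (p ℕ.^ a)) (^-assocʳ y p (p ℕ.^ a)) ⟩
    x ^ (p ℕ.* p ℕ.^ a) + y ^ (p ℕ.* p ℕ.^ a)       ∎

  -- Additivity applied to (x - y) + y; the sign (-1)^q and the distinction of p = 2 do not arise.
  [x-y]ᵖᵃ : ∀ a x y → (x - y) ^ (p ℕ.^ a) ≈ x ^ (p ℕ.^ a) - y ^ (p ℕ.^ a)
  [x-y]ᵖᵃ a x y = begin
    (x - y) ^ q                       ≈⟨ //-rightDividesʳ (y ^ q) _ ⟨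
    (x - y) ^ q + y ^ q - y ^ q       ≈⟨ +-congʳ ([x+y]ᵖᵃ a (x - y) y) ⟨
    (x - y + y) ^ q - y ^ q           ≈⟨ +-congʳ (^-congˡ q (//-rightDividesˡ y x)) ⟩
    x ^ q - y ^ q                     ∎
    where q = p ℕ.^ a

-- The characteristic of a finite Heyting field

module FieldCharacteristic (K : HeytingField c ℓ ℓ′) where
  private module K = HeytingField K
  open CommutativeRing (fieldRing K)
  open CommutativeExp commutativeSemiring using (_^_)
  open Mult semiring using (×1-homo-*; ×-homo-1) renaming (_×_ to _·_)
  open Sum semiring using (sum; sum-cong-≋; sum-permute; ∑-distrib-+; sum-replicate)
  open GroupProperties +-group using (∙-cancelˡ; //-rightDividesˡ; //-rightDividesʳ)
  open RingProperties ring using (-0#≈0#)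
  open SetoidReasoning setoid

  -- Translation by 1 fixes the sum of all elements and also increases it by q · 1.
  cardinality·1≈0 : ∀ {q} → HasCardinality K q → q · 1# ≈ 0#
  cardinality·1≈0 {q} card = sym (∙-cancelˡ (sum from) 0# (q · 1#) (begin
    sum from + 0#                     ≈⟨ +-identityʳ _ ⟩
    sum from                          ≈⟨ sum-permute from π ⟩
    sum (λ i → from (π ⟨$⟩ʳ i))       ≈⟨ sum-cong-≋ (λ i → strictlyInverseʳ (from i + 1#)) ⟩
    sum (λ i → from i + 1#)           ≈⟨ ∑-distrib-+ from (λ _ → 1#) ⟩
    sum from + sum {q} (λ _ → 1#)     ≈⟨ +-congˡ (sum-replicate q) ⟩
    sum from + q · 1#                 ∎))
    where
    open Inverse card
    π = permutation (λ i → to (from i + 1#)) (λ i → to (from i - 1#))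
      (λ i → ≡.trans (to-cong (trans (+-congʳ (strictlyInverseʳ _)) (//-rightDividesˡ 1# (from i))))
                     (strictlyInverseˡ i))
      (λ i → ≡.trans (to-cong (trans (+-congʳ (strictlyInverseʳ _)) (//-rightDividesʳ 1# (from i))))
                     (strictlyInverseˡ i))

  -- In the zero ring every difference is invertible, so 0 would be apart from itself.
  nontrivial : ¬ (1# ≈ 0#)
  nontrivial 1≈0 = K.#-irrefl refl (K.invertible⇒# {0#} {0#} (0# , collapse , collapse))
    where
    collapse : ∀ {x y} → x * y ≈ 1#
    collapse {x} {y} = trans (sym (*-identityˡ _)) (trans (*-congʳ 1≈0) (trans (zeroˡ _) (sym 1≈0)))

  -- Tightness of the apartness. It replaces the alternative "zero or invertible", which a Heyting
  -- field does not decide.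
  nonInvertible⇒0 : ∀ {x} → ¬ (∃ λ y → y * x ≈ 1#) → x ≈ 0#
  nonInvertible⇒0 {x} nonInvertible = proj₁ (K.tight x 0#) λ x#0 →
    let y , y[x-0]≈1 , _ = K.#⇒invertible x#0
    in nonInvertible (y , trans (*-congˡ (sym (trans (+-congˡ -0#≈0#) (+-identityʳ x)))) y[x-0]≈1)

  nilpotent⇒0 : ∀ x n → x ^ n ≈ 0# → x ≈ 0#
  nilpotent⇒0 x n xⁿ≈0 = nonInvertible⇒0 λ (y , yx≈1) → descend yx≈1 n xⁿ≈0
    where
    descend : ∀ {y} → y * x ≈ 1# → ∀ n → ¬ (x ^ n ≈ 0#)
    descend         _    zero    1≈0  = nontrivial 1≈0
    descend {y} yx≈1 (suc n) xⁿ≈0 = descend yx≈1 n (begin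
      x ^ n              ≈⟨ *-identityˡ _ ⟨
      1# * x ^ n         ≈⟨ *-congʳ yx≈1 ⟨
      y * x * x ^ n      ≈⟨ *-assoc y x _ ⟩
      y * (x * x ^ n)    ≈⟨ *-congˡ xⁿ≈0 ⟩
      y * 0#             ≈⟨ zeroʳ y ⟩
      0#                 ∎)

  characteristic : ∀ p e → HasCardinality K (p ℕ.^ e) → p annihilates fieldRing K
  characteristic p e card = nilpotent⇒0 (p · 1#) e (trans (power e) (cardinality·1≈0 card))
    where
    power : ∀ e → (p · 1#) ^ e ≈ (p ℕ.^ e) · 1#
    power zero    = sym (×-homo-1 1#)
    power (suc e) = trans (*-congˡ (power e)) (sym (×1-homo-* p (p ℕ.^ e)))

-- Lucas sequences

-- R[T] / (T² + b T + d); the pair (x , y) stands for x + y T.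
module QuadraticExtension (R : CommutativeRing c ℓ) (b d : CommutativeRing.Carrier R) where
  open CommutativeRing R
  open IntegerCoefficients R using (solve; _:=_; _:+_; _:*_; _:-_)
  open RingProperties ring using (-0#≈0#)

  quadraticExtension : CommutativeRing c ℓ
  quadraticExtension = record
    { Carrier = Carrier × Carrier
    ; _≈_ = λ (x , y) (z , w) → x ≈ z × y ≈ w
    ; _+_ = λ (x , y) (z , w) → x + z , y + w
    ; _*_ = λ (x , y) (z , w) → x * z - d * (y * w) , x * w + y * z - b * (y * w)
    ; -_  = λ (x , y) → - x , - y
    ; 0#  = 0# , 0#
    ; 1#  = 1# , 0#
    ; isCommutativeRing = record
      { isRing = record
        { +-isAbelianGroup = record
          { isGroup = record
            { isMonoid = record
              { isSemigroup = record
                { isMagma = record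
                  { isEquivalence = record
                    { refl = refl , refl
                    ; sym = λ (x≈ , y≈) → sym x≈ , sym y≈
                    ; trans = λ (x≈ , y≈) (x≈′ , y≈′) → trans x≈ x≈′ , trans y≈ y≈′
                    }
                  ; ∙-cong = λ (x≈ , y≈) (z≈ , w≈) → +-cong x≈ z≈ , +-cong y≈ w≈
                  }
                ; assoc = λ _ _ _ → +-assoc _ _ _ , +-assoc _ _ _
                }
              ; identity = (λ _ → +-identityˡ _ , +-identityˡ _) , (λ _ → +-identityʳ _ , +-identityʳ _)
              }
            ; inverse = (λ _ → -‿inverseˡ _ , -‿inverseˡ _) , (λ _ → -‿inverseʳ _ , -‿inverseʳ _)
            ; ⁻¹-cong = λ (x≈ , y≈) → -‿cong x≈ , -‿cong y≈
            }
          ; comm = λ _ _ → +-comm _ _ , +-comm _ _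
          }
        ; *-cong = λ (x≈ , y≈) (z≈ , w≈) →
            +-cong (*-cong x≈ z≈) (-‿cong (*-congˡ (*-cong y≈ w≈))) ,
            +-cong (+-cong (*-cong x≈ w≈) (*-cong y≈ z≈)) (-‿cong (*-congˡ (*-cong y≈ w≈)))
        ; *-assoc = λ (x , y) (z , w) (u , v) → assoc₁ x y z w u v , assoc₂ x y z w u v
        ; *-identity = ⊗-identityˡ , (λ z → trans₂ (⊗-comm z (1# , 0#)) (⊗-identityˡ z))
        ; distrib = (λ x y z → trans₂ (⊗-comm x _) (trans₂ (⊗-distribʳ x y z) (+₂ (⊗-comm y x) (⊗-comm z x))))
                  , ⊗-distribʳ
        }
      ; *-comm = ⊗-comm
      }
    }
    where
    trans₂ : ∀ {x y z w u v} → (x ≈ z × y ≈ w) → (z ≈ u × w ≈ v) → (x ≈ u × y ≈ v)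
    trans₂ (x≈ , y≈) (x≈′ , y≈′) = trans x≈ x≈′ , trans y≈ y≈′
    +₂ : ∀ {x y z w x′ y′ z′ w′} → (x ≈ x′ × y ≈ y′) → (z ≈ z′ × w ≈ w′) → (x + z ≈ x′ + z′ × y + w ≈ y′ + w′)
    +₂ (x≈ , y≈) (z≈ , w≈) = +-cong x≈ z≈ , +-cong y≈ w≈
    ⊗-comm : ∀ ((x , y) (z , w) : Carrier × Carrier) →
      (x * z - d * (y * w) ≈ z * x - d * (w * y)) ×
      (x * w + y * z - b * (y * w) ≈ z * y + w * x - b * (w * y))
    ⊗-comm (x , y) (z , w) =
      +-cong (*-comm x z) (-‿cong (*-congˡ (*-comm y w))) ,
      +-cong (trans (+-cong (*-comm x w) (*-comm y z)) (+-comm _ _)) (-‿cong (*-congˡ (*-comm y w)))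
    ⊗-identityˡ : ∀ ((x , y) : Carrier × Carrier) →
      (1# * x - d * (0# * y) ≈ x) × (1# * y + 0# * x - b * (0# * y) ≈ y)
    ⊗-identityˡ (x , y) =
      trans (+-cong (*-identityˡ x) (vanish d)) (+-identityʳ x) ,
      trans (+-cong (trans (+-cong (*-identityˡ y) (zeroˡ x)) (+-identityʳ y)) (vanish b)) (+-identityʳ y)
      where
      vanish : ∀ a → - (a * (0# * y)) ≈ 0#
      vanish a = trans (-‿cong (trans (*-congˡ (zeroˡ y)) (zeroʳ a))) -0#≈0#
    ⊗-distribʳ : ∀ ((x , y) (z , w) (u , v) : Carrier × Carrier) →
      ((z + u) * x - d * ((w + v) * y) ≈ (z * x - d * (w * y)) + (u * x - d * (v * y))) ×
      ((z + u) * y + (w + v) * x - b * ((w + v) * y) ≈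
        (z * y + w * x - b * (w * y)) + (u * y + v * x - b * (v * y)))
    ⊗-distribʳ (x , y) (z , w) (u , v) =
      solve 7 (λ d x y z w u v →
        (z :+ u) :* x :- d :* ((w :+ v) :* y) :=
        (z :* x :- d :* (w :* y)) :+ (u :* x :- d :* (v :* y))) refl d x y z w u v ,
      solve 7 (λ b x y z w u v →
        (z :+ u) :* y :+ (w :+ v) :* x :- b :* ((w :+ v) :* y) :=
        (z :* y :+ w :* x :- b :* (w :* y)) :+ (u :* y :+ v :* x :- b :* (v :* y))) refl b x y z w u v
    assoc₁ : ∀ x y z w u v →
      (x * z - d * (y * w)) * u - d * ((x * w + y * z - b * (y * w)) * v) ≈
      x * (z * u - d * (w * v)) - d * (y * (z * v + w * u - b * (w * v)))
    assoc₁ = solve 8 (λ b d x y z w u v →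
      (x :* z :- d :* (y :* w)) :* u :- d :* ((x :* w :+ y :* z :- b :* (y :* w)) :* v) :=
      x :* (z :* u :- d :* (w :* v)) :- d :* (y :* (z :* v :+ w :* u :- b :* (w :* v)))) refl b d
    assoc₂ : ∀ x y z w u v →
      (x * z - d * (y * w)) * v + (x * w + y * z - b * (y * w)) * u - b * ((x * w + y * z - b * (y * w)) * v) ≈
      x * (z * v + w * u - b * (w * v)) + y * (z * u - d * (w * v)) - b * (y * (z * v + w * u - b * (w * v)))
    assoc₂ = solve 8 (λ b d x y z w u v →
      (x :* z :- d :* (y :* w)) :* v :+ (x :* w :+ y :* z :- b :* (y :* w)) :* u
        :- b :* ((x :* w :+ y :* z :- b :* (y :* w)) :* v) :=
      x :* (z :* v :+ w :* u :- b :* (w :* v)) :+ y :* (z :* u :- d :* (w :* v))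
        :- b :* (y :* (z :* v :+ w :* u :- b :* (w :* v)))) refl b d

module LinearRecurrence (S : CommutativeRing c ℓ) (t d : CommutativeRing.Carrier S) where
  open CommutativeRing S
  open IntegerCoefficients S using (solve; _:=_; _:+_; _:*_; _:-_)
  open CommutativeExp commutativeSemiring using (_^_)
  open SetoidReasoning setoid

  Recurrent : (ℕ → Carrier) → Set ℓ
  Recurrent s = ∀ n → s (suc (suc n)) ≈ t * s (suc n) - d * s n

  Recurrent-unique : ∀ {s s′} → Recurrent s → Recurrent s′ →
                     s 0 ≈ s′ 0 → s 1 ≈ s′ 1 → ∀ n → s n ≈ s′ n
  Recurrent-unique {s} {s′} rec rec′ s₀ s₁ n = proj₁ (both n)
    where
    both : ∀ n → s n ≈ s′ n × s (suc n) ≈ s′ (suc n)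
    both zero    = s₀ , s₁
    both (suc n) = let eq , eq′ = both n in
      eq′ , trans (rec n) (trans (+-cong (*-congˡ eq′) (-‿cong (*-congˡ eq))) (sym (rec′ n)))

  Recurrent-+ : ∀ {s s′} → Recurrent s → Recurrent s′ → Recurrent (λ n → s n + s′ n)
  Recurrent-+ {s} {s′} rec rec′ n = trans (+-cong (rec n) (rec′ n))
    (solve 6 (λ t d x y x′ y′ → (t :* x :- d :* y) :+ (t :* x′ :- d :* y′) :=
                                t :* (x :+ x′) :- d :* (y :+ y′)) refl
       t d (s (suc n)) (s n) (s′ (suc n)) (s′ n))

  Recurrent-- : ∀ {s s′} → Recurrent s → Recurrent s′ → Recurrent (λ n → s n - s′ n)
  Recurrent-- {s} {s′} rec rec′ n = trans (+-cong (rec n) (-‿cong (rec′ n)))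
    (solve 6 (λ t d x y x′ y′ → (t :* x :- d :* y) :- (t :* x′ :- d :* y′) :=
                                t :* (x :- x′) :- d :* (y :- y′)) refl
       t d (s (suc n)) (s n) (s′ (suc n)) (s′ n))

  Recurrent-* : ∀ {s} x → Recurrent s → Recurrent (λ n → x * s n)
  Recurrent-* {s} x rec n = trans (*-congˡ (rec n))
    (solve 5 (λ t d x y z → x :* (t :* y :- d :* z) := t :* (x :* y) :- d :* (x :* z)) refl
       t d x (s (suc n)) (s n))

  Recurrent-^ : ∀ {α} → α * α ≈ t * α - d → Recurrent (α ^_)
  Recurrent-^ {α} α² n = begin
    α * (α * α ^ n)             ≈⟨ *-assoc α α _ ⟨
    α * α * α ^ n               ≈⟨ *-congʳ α² ⟩
    (t * α - d) * α ^ n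
      ≈⟨ solve 4 (λ t d a x → (t :* a :- d) :* x := t :* (a :* x) :- d :* x) refl t d α (α ^ n) ⟩
    t * (α * α ^ n) - d * α ^ n ∎

module LucasSequences (R : CommutativeRing c ℓ) where
  open CommutativeRing R
  open CommutativeExp commutativeSemiring using (_^_)
  open Mult semiring using () renaming (_×_ to _·_)

  -- The regularity of b is what later allows α - β to be cancelled.
  module CharacteristicP
    {p : ℕ} (p-prime : Prime p) (p·1≈0 : p annihilates R)
    (b d : Carrier) (b-regular : ∀ {x y} → b * x ≈ b * y → x ≈ y)
    (U V : ℕ → Carrier)
    (U-0 : U 0 ≈ 0#) (U-1 : U 1 ≈ 1#) (U-rec : ∀ n → U (suc (suc n)) ≈ - b * U (suc n) - d * U n)
    (V-0 : V 0 ≈ 2 · 1#) (V-1 : V 1 ≈ - b) (V-rec : ∀ n → V (suc (suc n)) ≈ - b * V (suc n) - d * V n)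
    where

    private
      open RingProperties ring using (-0#≈0#)
      open QuadraticExtension R b d
      module S = CommutativeRing quadraticExtension
      open CommutativeExp S.commutativeSemiring
        renaming (_^_ to _^ˢ_; ^-congˡ to ^ˢ-congˡ; ^-distrib-* to ^ˢ-distrib-*; ^-assocʳ to ^ˢ-assocʳ)
        using ()

      embed : Carrier → S.Carrier
      embed x = x , 0#

      embed-homo : IsHomomorphism R quadraticExtension embed
      embed-homo = record
        { isSemiringHomomorphism = record
          { isNearSemiringHomomorphism = record
            { +-isMonoidHomomorphism = record
              { isMagmaHomomorphism = record
                { isRelHomomorphism = record { cong = λ x≈y → x≈y , refl }
                ; homo = λ _ _ → refl , sym (+-identityˡ 0#)
                }
              ; ε-homo = refl , refl
              }
            ; *-homo = λ x y →
                sym (trans (+-congˡ (vanish d)) (+-identityʳ _)) ,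
                sym (trans (+-cong (trans (+-cong (zeroʳ x) (zeroˡ y)) (+-identityʳ 0#)) (vanish b)) (+-identityʳ 0#))
            }
          ; 1#-homo = refl , refl
          }
        ; -‿homo = λ _ → refl , sym -0#≈0#
        }
        where
        vanish : ∀ a → - (a * (0# * 0#)) ≈ 0#
        vanish a = trans (-‿cong (trans (*-congˡ (zeroʳ 0#)) (zeroʳ a))) -0#≈0#

      open IsHomomorphism R quadraticExtension embed-homo using (⟦⟧-cong; +-homo; *-homo)
      open HomomorphismProperties R quadraticExtension embed-homo using (^-homo; ·-homo; minus-homo)
      open Mult S.semiring using () renaming (_×_ to _·ˢ_)
      open Frobenius quadraticExtension p-prime (annihilates-homo R quadraticExtension embed-homo {p} p·1≈0)

      -- α is the class of T, and β is the other root, obtained from the trace t = -b.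
      t α β : S.Carrier
      t = embed (- b)
      α = 0# , 1#
      β = t S.- α

      α² : α S.* α S.≈ t S.* α S.- embed d
      α² = trans (+-congˡ (-‿cong (x*[1*1] d)))
             (solve 3 (λ b d o → con 0ℤ :* con 0ℤ :- d :=
               ((:- b) :* con 0ℤ :- d :* (con 0ℤ :* o)) :- d) refl b d 1#)
         , trans (+-congˡ (-‿cong (x*[1*1] b)))
           (trans (solve 2 (λ b o → con 0ℤ :* o :+ o :* con 0ℤ :- b :=
               ((:- b) :+ con 0ℤ :* con 0ℤ :- b :* (con 0ℤ :* o)) :- con 0ℤ) refl b 1#)
             (+-congʳ (+-congʳ (+-congʳ (sym (*-identityʳ (- b)))))))
        where
        open IntegerCoefficients R
        x*[1*1] : ∀ x → x * (1# * 1#) ≈ x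
        x*[1*1] x = trans (*-congˡ (*-identityˡ 1#)) (*-identityʳ x)

      -- This is α β = d.
      tα-αα : t S.* α S.- α S.* α S.≈ embed d
      tα-αα = S.trans (S.+-congˡ (S.-‿cong α²)) (solve 2 (λ x y → x :- (x :- y) := y) S.refl (t S.* α) (embed d))
        where open IntegerCoefficients quadraticExtension

      β² : β S.* β S.≈ t S.* β S.- embed d
      β² = S.trans (solve 2 (λ t a → (t :- a) :* (t :- a) := t :* (t :- a) :- (t :* a :- a :* a)) S.refl t α)
                   (S.+-congˡ (S.-‿cong tα-αα))
        where open IntegerCoefficients quadraticExtension

      δ : S.Carrier
      δ = α S.- β

      open LinearRecurrence quadraticExtension t (embed d)

      Recurrent-embed : ∀ {s : ℕ → Carrier} → (∀ n → s (suc (suc n)) ≈ - b * s (suc n) - d * s n) →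
                        Recurrent (λ n → embed (s n))
      Recurrent-embed {s} rec n = S.trans (⟦⟧-cong (rec n)) (S.trans (minus-homo _ _)
        (S.+-cong (*-homo (- b) (s (suc n))) (S.-‿cong (*-homo d (s n)))))

      V-Binet : ∀ n → embed (V n) S.≈ α ^ˢ n S.+ β ^ˢ n
      V-Binet = Recurrent-unique {λ n → embed (V n)} {λ n → α ^ˢ n S.+ β ^ˢ n}
        (Recurrent-embed {V} V-rec) (Recurrent-+ (Recurrent-^ α²) (Recurrent-^ β²))
        (S.trans (⟦⟧-cong (trans V-0 (+-congˡ (+-identityʳ 1#)))) (+-homo 1# 1#))
        (S.trans (⟦⟧-cong V-1) (S.trans (solve 2 (λ t a → t := a :+ (t :- a)) S.refl t α)
          (S.sym (S.+-cong (S.*-identityʳ α) (S.*-identityʳ β)))))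
        where open IntegerCoefficients quadraticExtension

      -- Kept in multiplied form, since δ need not be invertible; `δ-cancel` removes it at the end.
      U-Binet : ∀ n → δ S.* embed (U n) S.≈ α ^ˢ n S.- β ^ˢ n
      U-Binet = Recurrent-unique {λ n → δ S.* embed (U n)} {λ n → α ^ˢ n S.- β ^ˢ n}
        (Recurrent-* {λ n → embed (U n)} δ (Recurrent-embed {U} U-rec)) (Recurrent-- (Recurrent-^ α²) (Recurrent-^ β²))
        (S.trans (S.*-congˡ {δ} (⟦⟧-cong U-0)) (S.trans (S.zeroʳ δ) (S.sym (S.-‿inverseʳ S.1#))))
        (S.trans (S.*-congˡ {δ} (⟦⟧-cong U-1)) (S.trans (S.*-identityʳ δ)
          (S.sym (S.+-cong (S.*-identityʳ α) (S.-‿cong (S.*-identityʳ β))))))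

      ^-*-comm : ∀ x m n → x ^ˢ (m ℕ.* n) S.≈ (x ^ˢ n) ^ˢ m
      ^-*-comm x m n = S.trans (S.reflexive (≡.cong (x ^ˢ_) (ℕ.*-comm m n))) (S.sym (^ˢ-assocʳ x n m))

    V-frobenius : ∀ a n → V (p ℕ.^ a ℕ.* n) ≈ V n ^ (p ℕ.^ a)
    V-frobenius a n = proj₁ (begin
      embed (V (q ℕ.* n))                       ≈⟨ V-Binet (q ℕ.* n) ⟩
      α ^ˢ (q ℕ.* n) S.+ β ^ˢ (q ℕ.* n)         ≈⟨ S.+-cong (^-*-comm α q n) (^-*-comm β q n) ⟩
      (α ^ˢ n) ^ˢ q S.+ (β ^ˢ n) ^ˢ q           ≈⟨ [x+y]ᵖᵃ a (α ^ˢ n) (β ^ˢ n) ⟨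
      (α ^ˢ n S.+ β ^ˢ n) ^ˢ q                  ≈⟨ ^ˢ-congˡ q (V-Binet n) ⟨
      embed (V n) ^ˢ q                          ≈⟨ ^-homo (V n) q ⟨
      embed (V n ^ q)                           ∎)
      where
      open SetoidReasoning S.setoid
      q = p ℕ.^ a

    private
      -- δ = b + 2 T, and its constant term b is regular.
      δ-cancel : ∀ {x y} → δ S.* embed x S.≈ δ S.* embed y → x ≈ y
      δ-cancel {x} {y} eq = b-regular (trans (sym (first x)) (trans (proj₁ eq) (first y)))
        where
        open IntegerCoefficients R
        first : ∀ x → proj₁ (δ S.* embed x) ≈ b * x
        first x = solve 4 (λ b d x o →
          (con 0ℤ :- ((:- b) :- con 0ℤ)) :* x :- d :* ((o :- (con 0ℤ :- o)) :* con 0ℤ) := b :* x) refl b d x 1#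

      -- With q = p^a, Frobenius gives δ U_(qn) = (δ U_n)^q = δ^q U_n^q. Here e plays the part of
      -- δ^(q-1) and has to come from R so that δ can be cancelled.
      U-frobenius : ∀ a n {e} → δ ^ˢ (p ℕ.^ a) S.≈ δ S.* embed e →
                    U (p ℕ.^ a ℕ.* n) ≈ e * U n ^ (p ℕ.^ a)
      U-frobenius a n {e} δ^q = δ-cancel (begin
        δ S.* embed (U (q ℕ.* n))                 ≈⟨ U-Binet (q ℕ.* n) ⟩
        α ^ˢ (q ℕ.* n) S.- β ^ˢ (q ℕ.* n)         ≈⟨ S.+-cong (^-*-comm α q n) (S.-‿cong (^-*-comm β q n)) ⟩
        (α ^ˢ n) ^ˢ q S.- (β ^ˢ n) ^ˢ q           ≈⟨ [x-y]ᵖᵃ a (α ^ˢ n) (β ^ˢ n) ⟨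
        (α ^ˢ n S.- β ^ˢ n) ^ˢ q                  ≈⟨ ^ˢ-congˡ q (U-Binet n) ⟨
        (δ S.* embed (U n)) ^ˢ q                  ≈⟨ ^ˢ-distrib-* δ (embed (U n)) q ⟩
        δ ^ˢ q S.* embed (U n) ^ˢ q               ≈⟨ S.*-cong δ^q (S.sym (^-homo (U n) q)) ⟩
        δ S.* embed e S.* embed (U n ^ q)         ≈⟨ S.*-assoc δ (embed e) (embed (U n ^ q)) ⟩
        δ S.* (embed e S.* embed (U n ^ q))       ≈⟨ S.*-congˡ {δ} (*-homo e (U n ^ q)) ⟨
        δ S.* embed (e * U n ^ q)                 ∎)
        where
        open SetoidReasoning S.setoid
        q = p ℕ.^ a

      neg-square : ∀ x → - x * - x ≈ x ^ 2
      neg-square x = trans (solve 1 (λ x → (:- x) :* (:- x) := x :* x) refl x) (*-congˡ (sym (*-identityʳ x)))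
        where open IntegerCoefficients R

      δ² : δ ^ˢ 2 S.≈ embed (b ^ 2 - 4 · d)
      δ² = begin
        δ S.* (δ S.* S.1#)                  ≈⟨ S.*-congˡ {δ} (S.*-identityʳ δ) ⟩
        δ S.* δ
          -- (2 a - t)² = t² - 4 (t a - a²); the nested sum is the unfolding of `4 ·ˢ`.
          ≈⟨ solve 2 (λ t a → (a :- (t :- a)) :* (a :- (t :- a)) :=
               t :* t :- ((t :* a :- a :* a) :+ ((t :* a :- a :* a) :+
                         ((t :* a :- a :* a) :+ ((t :* a :- a :* a) :+ con 0ℤ)))))
               S.refl t α ⟩
        t S.* t S.- 4 ·ˢ (t S.* α S.- α S.* α)
          ≈⟨ S.+-cong t²  (S.-‿cong (Mult.×-congʳ S.semiring 4 tα-αα)) ⟩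
        embed (b ^ 2) S.- 4 ·ˢ embed d      ≈⟨ S.+-congˡ {embed (b ^ 2)} (S.-‿cong (·-homo 4 d)) ⟨
        embed (b ^ 2) S.- embed (4 · d)     ≈⟨ minus-homo (b ^ 2) (4 · d) ⟨
        embed (b ^ 2 - 4 · d)               ∎
        where
        open SetoidReasoning S.setoid
        open IntegerCoefficients quadraticExtension
        t² : t S.* t S.≈ embed (b ^ 2)
        t² = S.trans (S.sym (*-homo (- b) (- b))) (⟦⟧-cong (neg-square b))

    -- A power q of an odd prime is odd, so the integer division of q - 1 by 2 is exact. It splits
    -- δ^q as δ (δ²)^k.
    odd-power : 2 ∤ p → ∀ a → p ℕ.^ a ≡ suc (2 ℕ.* ((p ℕ.^ a ℕ.∸ 1) ℕ./ 2))
    odd-power 2∤p a = ≡.trans q≡1+[q-1]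
      (≡.cong suc (≡.trans (≡.sym (m/n*n≡m 2∣q-1)) (ℕ.*-comm ((q ℕ.∸ 1) ℕ./ 2) 2)))
      where
      q = p ℕ.^ a
      2∤pᵃ : ∀ a → 2 ∤ p ℕ.^ a
      2∤pᵃ zero    2∣1 = contradiction (ℕ.∣1⇒≡1 2∣1) λ ()
      2∤pᵃ (suc a) 2∣q with euclidsLemma p (p ℕ.^ a) prime[2] 2∣q
      ... | inj₁ 2∣p  = 2∤p 2∣p
      ... | inj₂ 2∣pᵃ = 2∤pᵃ a 2∣pᵃ
      q≡1+[q-1] : q ≡ suc (q ℕ.∸ 1)
      q≡1+[q-1] = ≡.sym (ℕ.suc-pred q {{ℕ.m^n≢0 p a {{prime⇒nonZero p-prime}}}})
      q%2≡1 : q ℕ.% 2 ≡ 1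
      q%2≡1 with q ℕ.% 2 in eq | m%n<n q 2
      ... | 0 | _ = contradiction (ℕ.m%n≡0⇒n∣m q 2 eq) (2∤pᵃ a)
      ... | 1 | _ = ≡.refl
      ... | suc (suc _) | s≤s (s≤s ())
      2∣q-1 : 2 ∣ q ℕ.∸ 1
      2∣q-1 = divides (q ℕ./ 2) (≡.cong (ℕ._∸ 1)
        (≡.trans (m≡m%n+[m/n]*n q 2) (≡.cong (ℕ._+ q ℕ./ 2 ℕ.* 2) q%2≡1)))

    U-frobenius-odd : 2 ∤ p → ∀ a n →
      U (p ℕ.^ a ℕ.* n) ≈ (b ^ 2 - 4 · d) ^ ((p ℕ.^ a ℕ.∸ 1) ℕ./ 2) * U n ^ (p ℕ.^ a)
    U-frobenius-odd 2∤p a n = U-frobenius a n (begin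
      δ ^ˢ (p ℕ.^ a)                        ≡⟨ ≡.cong (δ ^ˢ_) (odd-power 2∤p a) ⟩
      δ S.* δ ^ˢ (2 ℕ.* k)                  ≈⟨ S.*-congˡ {δ} (^ˢ-assocʳ δ 2 k) ⟨
      δ S.* (δ ^ˢ 2) ^ˢ k                   ≈⟨ S.*-congˡ {δ} (^ˢ-congˡ k δ²) ⟩
      δ S.* embed (b ^ 2 - 4 · d) ^ˢ k      ≈⟨ S.*-congˡ {δ} (^-homo (b ^ 2 - 4 · d) k) ⟨
      δ S.* embed ((b ^ 2 - 4 · d) ^ k)     ∎)
      where
      open SetoidReasoning S.setoid
      k = (p ℕ.^ a ℕ.∸ 1) ℕ./ 2

    U-frobenius-even : p ≡ 2 → ∀ a n →
      U (p ℕ.^ a ℕ.* n) ≈ b ^ (p ℕ.^ a ℕ.∸ 1) * U n ^ (p ℕ.^ a)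
    U-frobenius-even ≡.refl a n = U-frobenius a n (begin
      δ ^ˢ (2 ℕ.^ a)                        ≡⟨ ≡.cong (δ ^ˢ_) (ℕ.suc-pred (2 ℕ.^ a) {{ℕ.m^n≢0 2 a}}) ⟨
      δ S.* δ ^ˢ k                          ≈⟨ S.*-congˡ {δ} (^ˢ-congˡ k δ≈b) ⟩
      δ S.* embed b ^ˢ k                    ≈⟨ S.*-congˡ {δ} (^-homo b k) ⟨
      δ S.* embed (b ^ k)                   ∎)
      where
      open SetoidReasoning S.setoid
      k = 2 ℕ.^ a ℕ.∸ 1
      δ≈b : δ S.≈ embed b
      δ≈b = solve 1 (λ b → (con 0ℤ :- ((:- b) :- con 0ℤ)) := b) refl b ,
            trans (solve 1 (λ o → (o :- (con 0ℤ :- o)) := o :+ (o :+ con 0ℤ)) refl 1#) p·1≈0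
        where open IntegerCoefficients R

-- Lucas atoms

module CyclotomicModP (R : CommutativeRing c ℓ) {p : ℕ} (p-prime : Prime p)
  (p·1≈0 : p annihilates R) where

  private
    R[X] = Polynomial.polynomialRing R
    module ℤX = Polynomial ℤ.+-*-commutativeRing
    module R = CommutativeRing R
    module ℤ[X] = CommutativeRing ℤ[X]
  open CommutativeRing R[X]
  open Polynomial R using (X; ∷-cong; ≋-refl)
  open Polynomial using (Poly)
  open CommutativeExp commutativeSemiring using (_^_; ^-congˡ; ^-assocʳ)
  open CommutativeExp ℤ[X].commutativeSemiring using () renaming (_^_ to _^ᶻ_)
  open RangeProduct *-commutativeMonoid
  open IntegerCoefficients R
  private
    module Coefficients = HomomorphismProperties ℤ.+-*-commutativeRing R fromℤ-homo
    module M = HomomorphismProperties ℤ[X] R[X] Coefficients.map-homo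
  open IsHomomorphism ℤ[X] R[X] Coefficients.map-homo using (⟦⟧-cong; 1#-homo)
  open Frobenius R[X] p-prime (annihilates-homo R R[X] (PolynomialEvaluation.const-homo R) {p} p·1≈0)
  open SetoidReasoning setoid

  Ψ : ℕ → Poly R
  Ψ n = map fromℤ (Φ n)

  ∏∣Ψ : ∀ n → 1 ≤ n → ∏∣ n Ψ ≈ X ^ n - 1#
  ∏∣Ψ n 1≤n = begin
    ∏∣ n Ψ                                              ≈⟨ M.∏∣-homo n Φ ⟨
    map fromℤ (RangeProduct.∏∣ ℤ[X].*-commutativeMonoid n Φ)
                                                        ≈⟨ ⟦⟧-cong (∏Φ≈Xⁿ-1 n 1≤n) ⟩
    map fromℤ (ℤX.X ^ᶻ n ℤ[X].- ℤ[X].1#)                ≈⟨ M.minus-homo (ℤX.X ^ᶻ n) ℤ[X].1# ⟩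
    map fromℤ (ℤX.X ^ᶻ n) - map fromℤ ℤ[X].1#           ≈⟨ +-cong (M.^-homo ℤX.X n) (-‿cong 1#-homo) ⟩
    map fromℤ ℤX.X ^ n - 1#
      ≈⟨ +-congʳ (^-congˡ n (∷-cong R.refl (∷-cong fromℤ-1 ≋-refl))) ⟩
    X ^ n - 1#                                          ∎

  Ψ-cancellable : ∀ n → 1 ≤ n → Cancellable (Ψ n)
  Ψ-cancellable n 1≤n =
    PolynomialDivision.Monic-cancelʳ R (Coefficients.Monic-map {Φ n} (IsMonic.monic (Φ-monic n 1≤n)))

  Xᵐᵖ-1 : ∀ m → X ^ (m ℕ.* p) - 1# ≈ (X ^ m - 1#) ^ p
  Xᵐᵖ-1 m = sym (begin
    (X ^ m - 1#) ^ p              ≡⟨ ≡.cong ((X ^ m - 1#) ^_) (ℕ.*-identityʳ p) ⟨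
    (X ^ m - 1#) ^ (p ℕ.^ 1)      ≈⟨ [x-y]ᵖᵃ 1 (X ^ m) 1# ⟩
    (X ^ m) ^ (p ℕ.^ 1) - 1# ^ (p ℕ.^ 1)
      ≈⟨ +-cong (trans (^-assocʳ X m (p ℕ.^ 1)) (reflexive (≡.cong (λ k → X ^ (m ℕ.* k)) (ℕ.*-identityʳ p))))
                (-‿cong (1^ (p ℕ.^ 1))) ⟩
    X ^ (m ℕ.* p) - 1#            ∎)
    where
    1^ : ∀ n → 1# ^ n ≈ 1#
    1^ zero    = refl
    1^ (suc n) = trans (*-identityˡ _) (1^ n)

  -- The multiplicative instance of `prime-power`; its recursion comes from X^(mp) - 1 = (X^m -
  -- 1)^p, with both sides written as products over divisors.
  Ψ-prime-power : ∀ a m → 1 ≤ m → p ∤ m → Ψ (p ℕ.^ a ℕ.* m) ≈ Ψ m ^ φ (p ℕ.^ a)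
  Ψ-prime-power = PrimePowers.prime-power *-commutativeMonoid p-prime {Ψ} Ψ-cancellable
    (prime-step p-prime {Ψ} Ψ-cancellable λ m 1≤m → begin
      ∏∣ (m ℕ.* p) Ψ
        ≈⟨ ∏∣Ψ (m ℕ.* p) (ℕ.*-mono-≤ 1≤m (ℕ.>-nonZero⁻¹ p {{prime⇒nonZero p-prime}})) ⟩
      X ^ (m ℕ.* p) - 1#       ≈⟨ Xᵐᵖ-1 m ⟩
      (X ^ m - 1#) ^ p         ≈⟨ ^-congˡ p (∏∣Ψ m 1≤m) ⟨
      ∏∣ m Ψ ^ p               ∎)

-- If x - y were invertible, its image 0 would be invertible too; so x - y is not invertible and
-- vanishes by tightness.
field-homomorphism-injective : (F : HeytingField c ℓ ℓ′) (L : HeytingField f f₁ f₂) →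
  let module F = HeytingField F; module L = HeytingField L in
  ∀ {κ} → IsHomomorphism (fieldRing F) (fieldRing L) κ → ∀ {x y} → κ x L.≈ κ y → x F.≈ y
field-homomorphism-injective F L {κ} homo {x} {y} κx≈κy =
  GroupProperties.x∙y⁻¹≈ε⇒x≈y F.+-group x y
    (FieldCharacteristic.nonInvertible⇒0 F λ (z , z[x-y]≈1) →
      FieldCharacteristic.nontrivial L (begin
        L.1#                ≈⟨ 1#-homo ⟨
        κ F.1#              ≈⟨ ⟦⟧-cong z[x-y]≈1 ⟨
        κ (z F.* (x F.- y)) ≈⟨ *-homo z _ ⟩
        κ z L.* κ (x F.- y) ≈⟨ L.*-congˡ (minus-homo x y) ⟩
        κ z L.* (κ x L.- κ y) ≈⟨ L.*-congˡ (GroupProperties.x≈y⇒x∙y⁻¹≈ε L.+-group κx≈κy) ⟩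
        κ z L.* L.0#        ≈⟨ L.zeroʳ (κ z) ⟩
        L.0#                ∎))
  where
  module F = CommutativeRing (fieldRing F)
  module L = CommutativeRing (fieldRing L)
  open IsHomomorphism (fieldRing F) (fieldRing L) homo using (⟦⟧-cong; *-homo; 1#-homo)
  open HomomorphismProperties (fieldRing F) (fieldRing L) homo using (minus-homo)
  open SetoidReasoning L.setoid

constant-homo : (K : HeytingField c ℓ ℓ′) →
                IsHomomorphism (fieldRing K) (K[B,C] K) (Bivariate.constant K)
constant-homo K = Composition.isRingHomomorphism (Bivariate.trans K)
  (PolynomialEvaluation.const-homo (fieldRing K)) (PolynomialEvaluation.const-homo (K[B] K))

-- Homogenized cyclotomic values and Lucas atoms

module LucasAtomPrimePowers
  (K : HeytingField c ℓ ℓ′) {p : ℕ} (p-prime : Prime p)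
  (p·1≈0 : p annihilates fieldRing K)
  (F : FractionField (K[B,C] K) f f₁ f₂)
  (Ω : AlgebraicClosure (FractionField.fractions F) o o₁ o₂) where

  open LucasAtoms K F Ω
  private
    module BC = Bivariate K
    module K  = CommutativeRing (fieldRing K)
    open FractionField F using (fractions; ι; ι-mono)
    open AlgebraicClosure Ω using (closure; κ; κ-homo)
    L : CommutativeRing _ _
    L = fieldRing closure
    module ι = IsMonomorphism (K[B,C] K) (fieldRing fractions) ι-mono
  open CommutativeRing L
  open CommutativeExp commutativeSemiring
  open Polynomial L using (eval)
  open CyclotomicModP (fieldRing K) p-prime p·1≈0 using (Ψ; Ψ-prime-power)

  embed-homo : IsHomomorphism (K[B,C] K) L embed
  embed-homo = Composition.isRingHomomorphism trans ι.isRingHomomorphism κ-homo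

  embed-injective : ∀ {P Q} → embed P ≈ embed Q → P BC.≈ Q
  embed-injective eq = ι.injective (field-homomorphism-injective fractions closure κ-homo eq)

  coefficient-homo : IsHomomorphism (fieldRing K) L (λ a → embed (BC.constant a))
  coefficient-homo = Composition.isRingHomomorphism trans (constant-homo K) embed-homo

  value : Carrier → Polynomial.Poly (fieldRing K) → Carrier
  value x f = eval (map (λ a → embed (BC.constant a)) f) x

  -- `K[B] K` serves here as the one-variable polynomial ring that contains Ψ; its variable is
  -- evaluated at x and is unrelated to the Lucas parameter B.
  value-homo : ∀ x → IsHomomorphism (K[B] K) L (value x)
  value-homo x = Composition.isRingHomomorphism trans
    (HomomorphismProperties.map-homo (fieldRing K) L coefficient-homo)
    (PolynomialEvaluation.eval-homo L x)

  Φ-over-K≡Ψ : ∀ n → BC.Φ-over-K n ≡ Ψ n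
  Φ-over-K≡Ψ n = List.map-cong (λ { (+ _) → ≡.refl ; -[1+ _ ] → ≡.refl }) (Φ n)

  -- Because φ(q m) = φ(m) φ(q), the power of β is a φ(q)-th power just like the value of Ψ. The
  -- case m = 1 is included, with α - β on the right.
  Φʰᵒᵐ-prime-power : ∀ {α β} (roots : AreRoots α β) a m → 1 ≤ m → p ∤ m →
    Φʰᵒᵐ roots (p ℕ.^ a ℕ.* m) ≈ Φʰᵒᵐ roots m ^ φ (p ℕ.^ a)
  Φʰᵒᵐ-prime-power {α} {β} roots a m 1≤m p∤m = begin
    β ^ φ (q ℕ.* m) * value x (BC.Φ-over-K (q ℕ.* m))
      ≡⟨ ≡.cong₂ (λ k f → β ^ k * value x f)
           (≡.trans (φ-multiplicative p-prime a m 1≤m p∤m) (ℕ.*-comm (φ q) (φ m))) (Φ-over-K≡Ψ (q ℕ.* m)) ⟩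
    β ^ (φ m ℕ.* φ q) * value x (Ψ (q ℕ.* m))
      ≈⟨ *-cong (sym (^-assocʳ β (φ m) (φ q)))
           (trans (⟦⟧-cong (Ψ-prime-power a m 1≤m p∤m)) (^-homo (Ψ m) (φ q))) ⟩
    (β ^ φ m) ^ φ q * value x (Ψ m) ^ φ q
      ≈⟨ ^-distrib-* (β ^ φ m) (value x (Ψ m)) (φ q) ⟨
    (β ^ φ m * value x (Ψ m)) ^ φ q
      ≡⟨ ≡.cong (λ f → (β ^ φ m * value x f) ^ φ q) (Φ-over-K≡Ψ m) ⟨
    (β ^ φ m * value x (BC.Φ-over-K m)) ^ φ q   ∎
    where
    open SetoidReasoning setoid
    q = p ℕ.^ a
    x = α / β [ β#0 roots ]
    open IsHomomorphism (K[B] K) L (value-homo x) using (⟦⟧-cong)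
    open HomomorphismProperties (K[B] K) L (value-homo x) using (^-homo)

  atom-prime-power : ∀ {α β} (roots : AreRoots α β) (Λ : ℕ → BC.Carrier) →
    (∀ m → 1 ≤ m → IsLucasAtom roots m (Λ m)) → ∀ a m → 1 ≤ m → p ∤ m → (m ≡ 1 → a ≡ 0) →
    Λ (p ℕ.^ a ℕ.* m) BC.≈ Λ m BC.^ φ (p ℕ.^ a)
  -- Λ 1 is fixed by convention and is not a homogenized value; only a = 0 remains, where φ(p^0) =
  -- 1.
  atom-prime-power roots Λ atoms a (suc zero) 1≤m p∤m m≡1⇒a≡0 with m≡1⇒a≡0 ≡.refl
  ... | ≡.refl = BC.sym (BC.*-identityʳ (Λ 1))
  atom-prime-power roots Λ atoms a m@(suc (suc k)) 1≤m p∤m _ = embed-injective (begin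
    embed (Λ (q ℕ.* m))
      ≈⟨ proj₂ (atoms (q ℕ.* m) (ℕ.≤-trans 1≤m m≤qm)) (ℕ.≤-trans 2≤m m≤qm) ⟩
    Φʰᵒᵐ roots (q ℕ.* m)             ≈⟨ Φʰᵒᵐ-prime-power roots a m 1≤m p∤m ⟩
    Φʰᵒᵐ roots m ^ φ q               ≈⟨ ^-congˡ (φ q) (proj₂ (atoms m 1≤m) 2≤m) ⟨
    embed (Λ m) ^ φ q                ≈⟨ HomomorphismProperties.^-homo (K[B,C] K) L embed-homo (Λ m) (φ q) ⟨
    embed (Λ m BC.^ φ q)             ∎)
    where
    open SetoidReasoning setoid
    q = p ℕ.^ a
    2≤m : 2 ≤ m
    2≤m = s≤s (s≤s z≤n)
    m≤qm : m ≤ q ℕ.* m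
    m≤qm = ℕ.m≤n*m m q {{ℕ.m^n≢0 p a {{prime⇒nonZero p-prime}}}}

-- B is constant in C, so it multiplies each coefficient in K[B] separately, and there it is the
-- monic polynomial `X`.
B-regular : (K : HeytingField c ℓ ℓ′) → let open Bivariate K in ∀ {P Q} → B * P ≈ B * Q → P ≈ Q
B-regular K {P} {Q} eq .Polynomial.coeff-≈ i =
  KX.Monic-cancelʳ KX.Monic-X (K[Y].coeff P i) (K[Y].coeff Q i)
    (K[B].trans (K[B].*-comm (K[Y].coeff P i) X) (K[B].trans coeff-eq (K[B].*-comm X (K[Y].coeff Q i))))
  where
  module K[Y] = Polynomial (K[B] K)
  module K[B] = CommutativeRing (K[B] K)
  module KX = PolynomialDivision (fieldRing K)
  open Polynomial (fieldRing K) using (X)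
  open PolynomialDivision (K[B] K) using (coeff-const⊛)
  coeff-eq : X K[B].* K[Y].coeff P i K[B].≈ X K[B].* K[Y].coeff Q i
  coeff-eq = K[B].trans (K[B].sym (coeff-const⊛ X P i)) (K[B].trans (K[Y].coeff-≈ eq i) (coeff-const⊛ X Q i))

lemma3p6 : ∀ {c ℓ ℓ′ f f₁ f₂ o o₁ o₂}
    (p e q : ℕ) → Prime p → 1 ≤ e → q ≡ p ℕ.^ e →
    (𝔽q : HeytingField c ℓ ℓ′) → HasCardinality 𝔽q q →
    (n a n′ : ℕ) → 1 ≤ n → n ≡ p ℕ.^ a ℕ.* n′ → IsValuation p n a → gcd p n′ ≡ 1 →
    let open Bivariate 𝔽q in
    ( (F : FractionField (K[B,C] 𝔽q) f f₁ f₂)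
    (Ω : AlgebraicClosure (FractionField.fractions F) o o₁ o₂) →
    let open LucasAtoms 𝔽q F Ω in
    ∀ {α β} (roots : AreRoots α β) (Λ : ℕ → Carrier) →
    (∀ m → 1 ≤ m → IsLucasAtom roots m (Λ m)) →
    (n′ ≡ 1 → a ≡ 0) →
    Λ n ≈ Λ n′ ^ φ (p ℕ.^ a) )
    ×
    ( 𝒱 n ≈ 𝒱 n′ ^ (p ℕ.^ a) )
    ×
    ( ( 2 ∤ p →
    𝒰 n ≈ (B ^ 2 - 4 · C) ^ ((p ℕ.^ a ∸ 1) / 2) * 𝒰 n′ ^ (p ℕ.^ a) )
    ×
    ( p ≡ 2 →
    𝒰 n ≈ B ^ (2 ℕ.^ a ∸ 1) * 𝒰 n′ ^ (2 ℕ.^ a) ) )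
lemma3p6 p e _ p-prime _ ≡.refl 𝔽q card _ a n′ 1≤n ≡.refl _ gcd≡1 =
  (λ F Ω roots Λ atoms →
    LucasAtomPrimePowers.atom-prime-power 𝔽q p-prime p·1≈0 F Ω roots Λ atoms a n′ 1≤n′ p∤n′) ,
  V-frobenius a n′ ,
  (λ 2∤p → U-frobenius-odd 2∤p a n′) ,
  λ { ≡.refl → U-frobenius-even ≡.refl a n′ }
  where
  open Bivariate 𝔽q
  p·1≈0 = FieldCharacteristic.characteristic 𝔽q p e card
  p·1≈0′ = annihilates-homo (fieldRing 𝔽q) (K[B,C] 𝔽q) (constant-homo 𝔽q) {p} p·1≈0
  open LucasSequences (K[B,C] 𝔽q)
  open CharacteristicP p-prime p·1≈0′ B C (B-regular 𝔽q) 𝒰 𝒱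
    refl refl (λ _ → refl) refl refl (λ _ → refl)
  -- Otherwise p would be a common divisor of p and n′.
  p∤n′ : p ∤ n′
  p∤n′ p∣n′ = ℕ.nonTrivial⇒≢1 {{prime⇒nonTrivial p-prime}} (gcd≡1⇒coprime gcd≡1 (ℕ.∣-refl , p∣n′))
  1≤n′ : 1 ≤ n′
  1≤n′ = ℕ.n≢0⇒n>0 λ { ≡.refl → contradiction (ℕ.*-zeroʳ (p ℕ.^ a)) (ℕ.n>0⇒n≢0 1≤n) }
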